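{- The family $\{\mathbf{P}_J\}_{J}$, indexed by all pairs of twin binary trees $J$ and defined by $$\mathbf{P}_J := \sum_{\substack{\sigma \in \mathfrak{S} \\ \mathsf{P}(\sigma) = J}} \mathbf{F}_\sigma,$$ spans a Hopf subalgebra of $\mathbf{FQSym}$ (denoted $\mathbf{Baxter}$).
   Context: $\mathbb{K}$ is a field of characteristic zero. $\mathfrak{S}$ is the set of all permutations (of all sizes $n\ge 0$), seen as words. For a word $u$ over a totally ordered alphabet, $\mathrm{std}(u)$ is the unique permutation of size $|u|$ having the same inversions as $u$. $\mathbf{FQSym}$ is the graded Hopf algebra over $\mathbb{K}$ with basis $\{\mathbf{F}_\sigma\}_{\sigma\in\mathfrak{S}}$, product $\mathbf{F}_\sigma\cdot\mathbf{F}_\nu = \sum_{\pi} \mathbf{F}_\pi$, where $\pi$ runs over all shuffles of the word $\sigma$ with the word obtained by adding $|\sigma|$ to every letter of $\nu$, and coproduct $\Delta(\mathbf{F}_\sigma) = \sum_{\sigma = uv} \mathbf{F}_{\mathrm{std}(u)} \otimes \mathbf{F}_{\mathrm{std}(v)}$ (sum over all factorizations of the word $\sigma$, empty factors allowed). A binary tree is either a leaf (empty tree) or a node with a left and a right binary subtree. The canopy of a binary tree with $n$ nodes is the word of length $n-1$ on $\{0,1\}$ obtained by reading its leaves from left to right except the first and the last one, writing $0$ if the leaf is a right child and $1$ if it is a left child. A pair of twin binary trees is a pair $(T_L,T_R)$ of binary trees with the same number $n$ of nodes whose canopies differ at every position $1 \leq i \leq n-1$. For a permutation $\sigma$, $\mathsf{P}(\sigma)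 = (T_L,T_R)$ where $T_L$ (resp. $T_R$) is the shape (labels forgotten) of the binary search tree obtained by inserting the letters of $\sigma$ from left to right (resp. from right to left) with the standard binary search tree leaf insertion (smaller letters go left, larger letters go right). This is a pair of twin binary trees. -}

module Defs where

open import Level using (Level; _⊔_)
open import Function.Base using (_∘_; flip; const; id; case_of_)
open import Function.Bundles using (_⇔_; mk⇔)
open import Function.Construct.Composition using (_⇔-∘_)
open import Data.Bool.Base using (true; false; if_then_else_)
open import Data.Unit.Base using (⊤; tt)
open import Data.Sum.Base using (_⊎_; inj₁; inj₂)
open import Data.Product.Base using (Σ; ∃; _×_; _,_; map₁)
open import Data.Product.Properties using () renaming (≡-dec to ×-≡-dec)
open import Data.Fin.Patterns using (0F; 1F)
open import Data.Fin.Base using (Fin)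
open import Data.Nat.Base using (ℕ; zero; suc; 2+; _+_; _∸_; _≤_; _<_; z≤n; s≤s; _≤ᵇ_; _<ᵇ_)
open import Data.Nat.Properties as ℕₚ using (_<?_)
open import Data.List.Base
  using (List; []; _∷_; [_]; _++_; map; length; filter; mapMaybe; take; drop;
         upTo; applyUpTo; cartesianProductWith; zip; foldl; foldr)
open import Data.List.Properties as Listₚ using (length-map; length-++; map-applyUpTo)
open import Data.List.Membership.Propositional.Properties using (∈-∃++)
open import Data.List.Relation.Unary.All as All using (All; []; _∷_)
import Data.List.Relation.Unary.All.Properties as Allₚ
open import Data.List.Relation.Unary.AllPairs as AllPairs using (AllPairs; []; _∷_)
import Data.List.Relation.Unary.AllPairs.Properties as AllPairsₚ
open import Data.List.Relation.Unary.Any using (here)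
open import Data.List.Relation.Binary.Pointwise.Base using (Pointwise)
open import Data.List.Relation.Binary.Permutation.Propositional
  using (_↭_; ↭-refl; ↭-reflexive; ↭-sym; ↭-trans; prep; swap; module PermutationReasoning)
open import Data.List.Relation.Binary.Permutation.Propositional.Properties
  using (↭-length; ¬x∷xs↭[]; ∈-resp-↭; shift; drop-mid; ++⁺; map⁺)
open import Data.Maybe.Base using (Maybe; just; nothing)
open import Data.Tree.Binary using (Tree; leaf; node; #nodes) renaming (map to mapᵀ)
open import Relation.Nullary using (¬_; Dec; yes; no; does; contradiction)
open import Relation.Nullary.Decidable using (map′; _×-dec_)
open import Relation.Unary using (Pred)
open import Relation.Binary.Definitions using (DecidableEquality)
open import Relation.Binary.PropositionalEquality
  using (_≡_; _≢_; refl; sym; trans; cong; cong₂; subst; subst₂; module ≡-Reasoning)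
open import Algebra.Bundles using (Ring; CommutativeRing)
open import Algebra.Apartness.Bundles using (HeytingField; HeytingCommutativeRing)
open import Algebra.Module.Bundles using (LeftModule)
import Algebra.Definitions.RawMonoid
open import Algebra.Module.Morphism.Structures using (module LeftModuleMorphisms)

private
  variable
    a b c ℓ m ℓm i : Level

Word : Set
Word = List ℕ

[1⋯_] : ℕ → Word
[1⋯ n ] = applyUpTo suc n

IsPermutation : Word → Set
IsPermutation w = w ↭ [1⋯ length w ]

-- The proof is irrelevant, so two permutations are equal as soon as their
-- words are.
record 𝔖 : Set where
  constructor perm
  field
    word           : Word
    .isPermutation : IsPermutation word

open 𝔖 public

size : 𝔖 → ℕ
size σ = length (word σ)

word-injective : ∀ {σ τ} → word σ ≡ word τ → σ ≡ τ
word-injective refl = refl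

infix 4 _≟ᵂ_ _≟_ _↭?_

_≟ᵂ_ : DecidableEquality Word
_≟ᵂ_ = Listₚ.≡-dec ℕₚ._≟_

_≟_ : DecidableEquality 𝔖
σ ≟ τ = map′ word-injective (cong word) (word σ ≟ᵂ word τ)

_↭?_ : (u v : Word) → Dec (u ↭ v)
[]      ↭? []      = yes ↭-refl
[]      ↭? (y ∷ v) = no (¬x∷xs↭[] ∘ ↭-sym)
(x ∷ u) ↭? v       with x ∈? v
  where open import Data.List.Membership.DecPropositional ℕₚ._≟_ using (_∈?_)
... | no  x∉v = no λ p → x∉v (∈-resp-↭ p (here refl))
... | yes x∈v with ∈-∃++ x∈v
...   | v₁ , v₂ , refl = map′
        (λ p → ↭-trans (prep x p) (↭-sym (shift x v₁ v₂)))
        (drop-mid [] v₁)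
        (u ↭? v₁ ++ v₂)

isPermutation? : (w : Word) → Dec (IsPermutation w)
isPermutation? w = w ↭? [1⋯ length w ]

toPermutation : Word → Maybe 𝔖
toPermutation w with isPermutation? w
... | yes p = just (perm w p)
... | no  _ = nothing

words : List ℕ → ℕ → List Word
words A zero    = [ [] ]
words A (suc k) = cartesianProductWith _∷_ A (words A k)

-- All permutations of size n, each occurring exactly once.
𝔖[_] : ℕ → List 𝔖
𝔖[ n ] = mapMaybe toPermutation (words [1⋯ n ] n)

∅ : 𝔖
∅ = perm [] ↭-refl

bump : ℕ → ℕ → ℕ
bump k y = if y ≤ᵇ k then y else suc y

#smaller : ℕ → Word → ℕ
#smaller x u = length (filter (_<? x) u)

-- If k letters of u are smaller than x, the first letter of std (x ∷ u) has to
-- be k + 1, and the letters of std u exceeding k have to make room for it. A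
-- letter of u equal to x counts as larger than x, so that no inversion is
-- created between equal letters; see std-inversions.
std : Word → Word
std []      = []
std (x ∷ u) = suc (#smaller x u) ∷ map (bump (#smaller x u)) (std u)

length-std : ∀ u → length (std u) ≡ length u
length-std []      = refl
length-std (x ∷ u) = cong suc (trans (length-map _ (std u)) (length-std u))

bump-suc : ∀ k y → bump (suc k) (suc y) ≡ suc (bump k y)
bump-suc k zero    = refl
bump-suc k (suc y) with y <ᵇ k
... | true  = refl
... | false = refl

map-bump-suc : ∀ k w → map (bump (suc k)) (map suc w) ≡ map suc (map (bump k) w)
map-bump-suc k []      = refl
map-bump-suc k (y ∷ w) = cong₂ _∷_ (bump-suc k y) (map-bump-suc k w)

[1⋯]-suc : ∀ n → [1⋯ suc n ] ≡ 1 ∷ map suc [1⋯ n ]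
[1⋯]-suc n = cong (1 ∷_) (sym (map-applyUpTo suc suc n))

bump-[1⋯] : ∀ {k n} → k ≤ n → suc k ∷ map (bump k) [1⋯ n ] ↭ [1⋯ suc n ]
bump-[1⋯] {zero}  {n} _ = ↭-reflexive (cong (1 ∷_) (map-applyUpTo suc (bump 0) n))
bump-[1⋯] {suc k} {suc n} (s≤s k≤n) = begin
  2+ k ∷ map (bump (suc k)) [1⋯ suc n ]            ≡⟨ cong (λ w → 2+ k ∷ map (bump (suc k)) w) ([1⋯]-suc n) ⟩
  2+ k ∷ 1 ∷ map (bump (suc k)) (map suc [1⋯ n ])  ≡⟨ cong (λ w → 2+ k ∷ 1 ∷ w) (map-bump-suc k [1⋯ n ]) ⟩
  2+ k ∷ 1 ∷ map suc (map (bump k) [1⋯ n ])        ↭⟨ swap _ _ ↭-refl ⟩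
  1 ∷ map suc (suc k ∷ map (bump k) [1⋯ n ])       ↭⟨ prep 1 (map⁺ suc (bump-[1⋯] k≤n)) ⟩
  1 ∷ map suc [1⋯ suc n ]                          ≡⟨ [1⋯]-suc (suc n) ⟨
  [1⋯ 2+ n ]                                       ∎
  where open PermutationReasoning

std-isPermutation : ∀ u → IsPermutation (std u)
std-isPermutation u = subst (λ n → std u ↭ [1⋯ n ]) (sym (length-std u)) (go u)
  where
  go : ∀ u → std u ↭ [1⋯ length u ]
  go []      = ↭-refl
  go (x ∷ u) = ↭-trans (prep _ (map⁺ _ (go u)))
                       (bump-[1⋯] (Listₚ.length-filter (_<? x) u))

Std : Word → 𝔖
Std u = perm (std u) (std-isPermutation u)

bump-cases : ∀ k y → (y ≤ k × bump k y ≡ y) ⊎ (k < y × bump k y ≡ suc y)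
bump-cases k y with y ≤ᵇ k | ℕₚ.≤ᵇ⇒≤ y k | ℕₚ.≤⇒≤ᵇ {y} {k}
... | true  | f | _ = inj₁ (f _ , refl)
... | false | _ | g = inj₂ (ℕₚ.≰⇒> g , refl)

bump-≤ : ∀ {k c} → c ≤ k → ∀ s → bump k s ≤ c ⇔ s ≤ c
bump-≤ {k} {c} c≤k s with bump k s | bump-cases k s
... | _ | inj₁ (_   , refl) = mk⇔ id id
... | _ | inj₂ (k<s , refl) = mk⇔ ℕₚ.<⇒≤
  λ s≤c → contradiction (ℕₚ.≤-trans s≤c c≤k) (ℕₚ.<⇒≱ k<s)

bump-≤1+ : ∀ {k c} → k ≤ c → ∀ s → bump k s ≤ suc c ⇔ s ≤ c
bump-≤1+ {k} {c} k≤c s with bump k s | bump-cases k s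
... | _ | inj₁ (s≤k , refl) = mk⇔ (const (ℕₚ.≤-trans s≤k k≤c)) ℕₚ.m≤n⇒m≤1+n
... | _ | inj₂ (_   , refl) = mk⇔ ℕₚ.≤-pred s≤s

bump-< : ∀ k s t → bump k s < bump k t ⇔ s < t
bump-< k s t with bump k s | bump-cases k s | bump k t | bump-cases k t
... | _ | inj₁ (_   , refl) | _ | inj₁ (_   , refl) = mk⇔ id id
... | _ | inj₁ (s≤k , refl) | _ | inj₂ (k<t , refl) =
  mk⇔ (const (ℕₚ.≤-<-trans s≤k k<t)) ℕₚ.m≤n⇒m≤1+n
... | _ | inj₂ (k<s , refl) | _ | inj₁ (t≤k , refl) = mk⇔ ℕₚ.<⇒≤
  λ s<t → contradiction (ℕₚ.≤-trans (ℕₚ.<⇒≤ s<t) t≤k) (ℕₚ.<⇒≱ k<s)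
... | _ | inj₂ (_   , refl) | _ | inj₂ (_   , refl) = mk⇔ ℕₚ.≤-pred s≤s

#smaller-accept : ∀ {x z} → z < x → ∀ u → #smaller x (z ∷ u) ≡ suc (#smaller x u)
#smaller-accept z<x u = cong length (Listₚ.filter-accept (_<? _) z<x)

#smaller-reject : ∀ {x z} → ¬ z < x → ∀ u → #smaller x (z ∷ u) ≡ #smaller x u
#smaller-reject z≮x u = cong length (Listₚ.filter-reject (_<? _) z≮x)

#smaller-mono : ∀ {x y} → x ≤ y → ∀ u → #smaller x u ≤ #smaller y u
#smaller-mono         x≤y []      = z≤n
#smaller-mono {x} {y} x≤y (z ∷ u) = go (z <? x) (z <? y)
  where
  ih = #smaller-mono x≤y u
  go : Dec (z < x) → Dec (z < y) → #smaller x (z ∷ u) ≤ #smaller y (z ∷ u)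
  go (yes z<x) (no  z≮y) = contradiction (ℕₚ.<-≤-trans z<x x≤y) z≮y
  go (yes z<x) (yes z<y) = subst₂ _≤_ (sym (#smaller-accept z<x u)) (sym (#smaller-accept z<y u)) (s≤s ih)
  go (no  z≮x) (yes z<y) = subst₂ _≤_ (sym (#smaller-reject z≮x u)) (sym (#smaller-accept z<y u)) (ℕₚ.m≤n⇒m≤1+n ih)
  go (no  z≮x) (no  z≮y) = subst₂ _≤_ (sym (#smaller-reject z≮x u)) (sym (#smaller-reject z≮y u)) ih

zip-map : ∀ (f : ℕ → ℕ) (v w : Word) → map (map₁ f) (zip v w) ≡ zip (map f v) w
zip-map f []      w       = refl
zip-map f (_ ∷ v) []      = refl
zip-map f (_ ∷ v) (_ ∷ w) = cong (_ ∷_) (zip-map f v w)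

std-≤ : ∀ x u → All (λ (s , y) → s ≤ #smaller x u ⇔ y < x) (zip (std u) u)
std-≤ x []      = []
std-≤ x (y ∷ u) = case y <? x of λ where
    (yes y<x) → let k≤c = #smaller-mono (ℕₚ.<⇒≤ y<x) u in
      subst (λ c → All (Q c) _) (sym (#smaller-accept y<x u))
        (mk⇔ (const y<x) (const (s≤s k≤c))
        ∷ tail (All.map (_⇔-∘ bump-≤1+ k≤c _) (std-≤ x u)))
    (no y≮x) → let c≤k = #smaller-mono (ℕₚ.≮⇒≥ y≮x) u in
      subst (λ c → All (Q c) _) (sym (#smaller-reject y≮x u))
        (mk⇔ (λ k<c → contradiction c≤k (ℕₚ.<⇒≱ k<c)) (λ y<x → contradiction y<x y≮x)
        ∷ tail (All.map (_⇔-∘ bump-≤ c≤k _) (std-≤ x u)))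
  where
  k = #smaller y u
  Q : ℕ → ℕ × ℕ → Set
  Q c (s , z) = s ≤ c ⇔ z < x
  tail : ∀ {c} → All (Q c ∘ map₁ (bump k)) (zip (std u) u) →
         All (Q c) (zip (map (bump k) (std u)) u)
  tail {c} ps = subst (All (Q c)) (zip-map (bump k) (std u) u) (Allₚ.map⁺ ps)

-- The property characterizing std u among the permutations of size length u:
-- at any two positions it has an inversion if and only if u has one.
std-inversions : ∀ u → AllPairs (λ (s , x) (t , y) → t < s ⇔ y < x) (zip (std u) u)
std-inversions []      = []
std-inversions (x ∷ u) = subst (λ z → AllPairs R ((suc k , x) ∷ z)) (zip-map (bump k) (std u) u)
  ( Allₚ.map⁺ (All.map (λ e → e ⇔-∘ (bump-≤ ℕₚ.≤-refl _ ⇔-∘ mk⇔ ℕₚ.≤-pred s≤s)) (std-≤ x u))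
  ∷ AllPairsₚ.map⁺ (AllPairs.map (_⇔-∘ bump-< k _ _) (std-inversions u)))
  where
  k = #smaller x u
  R : ℕ × ℕ → ℕ × ℕ → Set
  R (s , y) (t , z) = t < s ⇔ z < y

infixr 6 _⧢_

_⧢_ : Word → Word → List Word
[]      ⧢ v       = [ v ]
(x ∷ u) ⧢ []      = [ x ∷ u ]
(x ∷ u) ⧢ (y ∷ v) = map (x ∷_) (u ⧢ (y ∷ v)) ++ map (y ∷_) ((x ∷ u) ⧢ v)

⧢-↭ : ∀ u v → All (_↭ u ++ v) (u ⧢ v)
⧢-↭ []      v       = ↭-refl ∷ []
⧢-↭ (x ∷ u) []      rewrite Listₚ.++-identityʳ u = ↭-refl ∷ []
⧢-↭ (x ∷ u) (y ∷ v) = Allₚ.++⁺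
  (Allₚ.map⁺ (All.map (prep x) (⧢-↭ u (y ∷ v))))
  (Allₚ.map⁺ (All.map (λ p → ↭-trans (prep y p) (↭-sym (shift y (x ∷ u) v)))
                      (⧢-↭ (x ∷ u) v)))

shiftBy : ℕ → Word → Word
shiftBy k = map (k +_)

[1⋯]-+ : ∀ m n → [1⋯ m ] ++ shiftBy m [1⋯ n ] ≡ [1⋯ m + n ]
[1⋯]-+ zero    n = Listₚ.map-id [1⋯ n ]
[1⋯]-+ (suc m) n = begin
  [1⋯ suc m ] ++ shiftBy (suc m) [1⋯ n ]
    ≡⟨ cong₂ _++_ ([1⋯]-suc m) (Listₚ.map-∘ [1⋯ n ]) ⟩
  1 ∷ map suc [1⋯ m ] ++ map suc (shiftBy m [1⋯ n ])
    ≡⟨ cong (1 ∷_) (Listₚ.map-++ suc [1⋯ m ] (shiftBy m [1⋯ n ])) ⟨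
  1 ∷ map suc ([1⋯ m ] ++ shiftBy m [1⋯ n ])
    ≡⟨ cong (λ w → 1 ∷ map suc w) ([1⋯]-+ m n) ⟩
  1 ∷ map suc [1⋯ m + n ]
    ≡⟨ [1⋯]-suc (m + n) ⟨
  [1⋯ suc m + n ] ∎
  where open ≡-Reasoning

↭-isPermutation : ∀ {u v w} → IsPermutation u → IsPermutation v →
                  w ↭ u ++ shiftBy (length u) v → IsPermutation w
↭-isPermutation {u} {v} {w} p q r = begin
  w                                                   ↭⟨ r ⟩
  u ++ shiftBy (length u) v                           ↭⟨ ++⁺ p (map⁺ _ q) ⟩
  [1⋯ length u ] ++ shiftBy (length u) [1⋯ length v ] ≡⟨ [1⋯]-+ (length u) (length v) ⟩
  [1⋯ length u + length v ]                           ≡⟨ cong [1⋯_] length-w ⟨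
  [1⋯ length w ]                                      ∎
  where
  open PermutationReasoning
  length-w : length w ≡ length u + length v
  length-w = trans (↭-length r)
    (trans (length-++ u) (cong (length u +_) (length-map _ v)))

attach : (ws : List Word) → .(All IsPermutation ws) → List 𝔖
attach []       _  = []
attach (w ∷ ws) ps = perm w (All.head ps) ∷ attach ws (All.tail ps)

infixr 6 _⧢̅_

-- The shuffles of σ with ν shifted by the size of σ.
_⧢̅_ : 𝔖 → 𝔖 → List 𝔖
perm u p ⧢̅ perm v q = attach (u ⧢ shiftBy (length u) v)
  (All.map (↭-isPermutation {u} {v} p q) (⧢-↭ u (shiftBy (length u) v)))

BinaryTree : Set
BinaryTree = Tree ⊤ ⊤

infix 4 _≟ᵀ_

_≟ᵀ_ : DecidableEquality BinaryTree
leaf _     ≟ᵀ leaf _        = yes refl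
leaf _     ≟ᵀ node _ _ _    = no λ ()
node _ _ _ ≟ᵀ leaf _        = no λ ()
node l _ r ≟ᵀ node l₁ _ r₁  = map′
  (λ { (refl , refl) → refl }) (λ { refl → refl , refl }) (l ≟ᵀ l₁ ×-dec r ≟ᵀ r₁)

-- The leaves from left to right: 0 for a right child, 1 for a left child. The
-- first argument is the entry for the tree itself in case it is a leaf.
leaves : Fin 2 → BinaryTree → List (Fin 2)
leaves d (leaf _)     = [ d ]
leaves d (node l _ r) = leaves 1F l ++ leaves 0F r

-- A tree with n nodes has n + 1 leaves, so that dropping the first one and
-- then keeping n ∸ 1 removes exactly the first and the last. The entry 0F is
-- never kept: it is dropped when t is a leaf and unused otherwise.
canopy : BinaryTree → List (Fin 2)
canopy t = take (#nodes t ∸ 1) (drop 1 (leaves 0F t))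

record TwinPair : Set where
  field
    left right : BinaryTree
    same-size  : #nodes left ≡ #nodes right
    twin       : Pointwise _≢_ (canopy left) (canopy right)

  trees : BinaryTree × BinaryTree
  trees = left , right

open TwinPair public using (trees)

-- Labels are inserted in permutations only, so that the case x ≡ y is immaterial.
insert : ℕ → Tree ℕ ⊤ → Tree ℕ ⊤
insert x (leaf _)     = node (leaf tt) x (leaf tt)
insert x (node l y r) with x <? y
... | yes _ = node (insert x l) y r
... | no  _ = node l y (insert x r)

shape : Tree ℕ ⊤ → BinaryTree
shape = mapᵀ (const tt) (const tt)

P : 𝔖 → BinaryTree × BinaryTree
P σ = shape (foldl (flip insert) (leaf tt) (word σ))
    , shape (foldr insert (leaf tt) (word σ))

infix 4 _≟ᴾ_

_≟ᴾ_ : DecidableEquality (BinaryTree × BinaryTree)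
_≟ᴾ_ = ×-≡-dec _≟ᵀ_ _≟ᵀ_

-- The free module with basis B: formal linear combinations of elements of B,
-- equal when all their coefficients are.
module FreeModule (R : Ring c ℓ) {B : Set b} (_≟ᴮ_ : DecidableEquality B) where

  open Ring R
    renaming (_+_ to _+ᴿ_; refl to ≈-refl; sym to ≈-sym; trans to ≈-trans)

  Lin : Set (c ⊔ b)
  Lin = List (Carrier × B)

  coeff : B → Lin → Carrier
  coeff e []            = 0#
  coeff e ((k , f) ∷ x) = (if does (e ≟ᴮ f) then k else 0#) +ᴿ coeff e x

  infix 4 _≋_

  record _≋_ (x y : Lin) : Set (b ⊔ ℓ) where
    constructor mk≋
    field
      coeff-≈ : ∀ e → coeff e x ≈ coeff e y

  open _≋_ public

  scale : Carrier → Lin → Lin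
  scale k = map λ (l , e) → k * l , e

  private
    open import Algebra.Properties.Ring R using (-1*x≈-x)
    open import Relation.Binary.Reasoning.Setoid setoid

  coeff-++ : ∀ e x y → coeff e (x ++ y) ≈ coeff e x +ᴿ coeff e y
  coeff-++ e []      y = ≈-sym (+-identityˡ _)
  coeff-++ e (_ ∷ x) y = ≈-trans (+-congˡ (coeff-++ e x y)) (≈-sym (+-assoc _ _ _))

  coeff-scale : ∀ e k x → coeff e (scale k x) ≈ k * coeff e x
  coeff-scale e k []            = ≈-sym (zeroʳ k)
  coeff-scale e k ((l , f) ∷ x) = ≈-trans (+-cong head (coeff-scale e k x)) (≈-sym (distribˡ _ _ _))
    where
    head : (if does (e ≟ᴮ f) then k * l else 0#) ≈ k * (if does (e ≟ᴮ f) then l else 0#)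
    head with does (e ≟ᴮ f)
    ... | true  = ≈-refl
    ... | false = ≈-sym (zeroʳ k)

  coeff-neg : ∀ e x → coeff e (scale (- 1#) x) ≈ - coeff e x
  coeff-neg e x = ≈-trans (coeff-scale e (- 1#) x) (-1*x≈-x _)

  leftModule : LeftModule R (c ⊔ b) (b ⊔ ℓ)
  leftModule = record
    { Carrierᴹ = Lin
    ; _≈ᴹ_     = _≋_
    ; _+ᴹ_     = _++_
    ; _*ₗ_     = scale
    ; 0ᴹ       = []
    ; -ᴹ_      = scale (- 1#)
    ; isLeftModule = record
      { isLeftSemimodule = record
        { +ᴹ-isCommutativeMonoid = record
          { isMonoid = record
            { isSemigroup = record
              { isMagma = record
                { isEquivalence = record
                  { refl  = mk≋ λ _ → ≈-refl
                  ; sym   = λ p → mk≋ λ e → ≈-sym (coeff-≈ p e)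
                  ; trans = λ p q → mk≋ λ e → ≈-trans (coeff-≈ p e) (coeff-≈ q e)
                  }
                ; ∙-cong = λ {x} {y} {u} {v} p q → mk≋ λ e → begin
                    coeff e (x ++ u)        ≈⟨ coeff-++ e x u ⟩
                    coeff e x +ᴿ coeff e u  ≈⟨ +-cong (coeff-≈ p e) (coeff-≈ q e) ⟩
                    coeff e y +ᴿ coeff e v  ≈⟨ coeff-++ e y v ⟨
                    coeff e (y ++ v)        ∎
                }
              ; assoc = λ x y z → mk≋ λ e → reflexive (cong (coeff e) (Listₚ.++-assoc x y z))
              }
            ; identity = (λ x → mk≋ λ e → ≈-refl)
                       , (λ x → mk≋ λ e → reflexive (cong (coeff e) (Listₚ.++-identityʳ x)))
            }
          ; comm = λ x y → mk≋ λ e → begin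
              coeff e (x ++ y)        ≈⟨ coeff-++ e x y ⟩
              coeff e x +ᴿ coeff e y  ≈⟨ +-comm _ _ ⟩
              coeff e y +ᴿ coeff e x  ≈⟨ coeff-++ e y x ⟨
              coeff e (y ++ x)        ∎
          }
        ; isPreleftSemimodule = record
          { *ₗ-cong = λ {k} {l} {x} {y} p q → mk≋ λ e → begin
              coeff e (scale k x)  ≈⟨ coeff-scale e k x ⟩
              k * coeff e x        ≈⟨ *-cong p (coeff-≈ q e) ⟩
              l * coeff e y        ≈⟨ coeff-scale e l y ⟨
              coeff e (scale l y)  ∎
          ; *ₗ-zeroˡ = λ x → mk≋ λ e → ≈-trans (coeff-scale e 0# x) (zeroˡ _)
          ; *ₗ-distribʳ = λ x k l → mk≋ λ e → begin
              coeff e (scale (k +ᴿ l) x)                  ≈⟨ coeff-scale e (k +ᴿ l) x ⟩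
              (k +ᴿ l) * coeff e x                        ≈⟨ distribʳ _ _ _ ⟩
              k * coeff e x +ᴿ l * coeff e x              ≈⟨ +-cong (coeff-scale e k x) (coeff-scale e l x) ⟨
              coeff e (scale k x) +ᴿ coeff e (scale l x)  ≈⟨ coeff-++ e (scale k x) (scale l x) ⟨
              coeff e (scale k x ++ scale l x)            ∎
          ; *ₗ-identityˡ = λ x → mk≋ λ e → ≈-trans (coeff-scale e 1# x) (*-identityˡ _)
          ; *ₗ-assoc = λ k l x → mk≋ λ e → begin
              coeff e (scale (k * l) x)    ≈⟨ coeff-scale e (k * l) x ⟩
              (k * l) * coeff e x          ≈⟨ *-assoc _ _ _ ⟩
              k * (l * coeff e x)          ≈⟨ *-congˡ (coeff-scale e l x) ⟨
              k * coeff e (scale l x)      ≈⟨ coeff-scale e k (scale l x) ⟨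
              coeff e (scale k (scale l x)) ∎
          ; *ₗ-zeroʳ = λ k → mk≋ λ e → ≈-refl
          ; *ₗ-distribˡ = λ k x y → mk≋ λ e → reflexive (cong (coeff e) (Listₚ.map-++ _ x y))
          }
        }
      ; -ᴹ‿cong = λ {x} {y} p → mk≋ λ e → begin
          coeff e (scale (- 1#) x)  ≈⟨ coeff-neg e x ⟩
          - coeff e x               ≈⟨ -‿cong (coeff-≈ p e) ⟩
          - coeff e y               ≈⟨ coeff-neg e y ⟨
          coeff e (scale (- 1#) y)  ∎
      ; -ᴹ‿inverse =
            (λ x → mk≋ λ e → begin
              coeff e (scale (- 1#) x ++ x)           ≈⟨ coeff-++ e (scale (- 1#) x) x ⟩
              coeff e (scale (- 1#) x) +ᴿ coeff e x   ≈⟨ +-congʳ (coeff-neg e x) ⟩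
              - coeff e x +ᴿ coeff e x                ≈⟨ -‿inverseˡ _ ⟩
              0#                                      ∎)
          , (λ x → mk≋ λ e → begin
              coeff e (x ++ scale (- 1#) x)           ≈⟨ coeff-++ e x (scale (- 1#) x) ⟩
              coeff e x +ᴿ coeff e (scale (- 1#) x)   ≈⟨ +-congˡ (coeff-neg e x) ⟩
              coeff e x +ᴿ - coeff e x                ≈⟨ -‿inverseʳ _ ⟩
              0#                                      ∎)
      }
    }

module _ {R : Ring c ℓ} (M : LeftModule R m ℓm) where

  open Ring R using (Carrier)
  open LeftModule M

  linearCombination : {I : Set i} → (I → Carrierᴹ) → List (Carrier × I) → Carrierᴹ
  linearCombination v []             = 0ᴹ
  linearCombination v ((k , j) ∷ ks) = k *ₗ v j +ᴹ linearCombination v ks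

  Span : {I : Set i} → (I → Carrierᴹ) → Pred Carrierᴹ _
  Span v x = ∃ λ ks → x ≈ᴹ linearCombination v ks

  record IsSubspace {p} (V : Pred Carrierᴹ p) : Set (c ⊔ m ⊔ ℓm ⊔ p) where
    field
      resp-≈    : ∀ {x y} → x ≈ᴹ y → V x → V y
      0-closed  : V 0ᴹ
      +-closed  : ∀ {x y} → V x → V y → V (x +ᴹ y)
      *ₗ-closed : ∀ k {x} → V x → V (k *ₗ x)

-- Classically, a Heyting field with x # y given by ¬ x ≈ y is just a field.
CharacteristicZero : ∀ {c ℓ₁ ℓ₂} → HeytingField c ℓ₁ ℓ₂ → Set ℓ₁
CharacteristicZero K = ∀ n → ¬ (suc n · 1# ≈ 0#)
  where
  open HeytingField K
  open CommutativeRing (HeytingCommutativeRing.commutativeRing heytingCommutativeRing)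
    using (+-rawMonoid)
  open Algebra.Definitions.RawMonoid +-rawMonoid using () renaming (_×_ to _·_)

module FQSym {c ℓ₁ ℓ₂} (K : HeytingField c ℓ₁ ℓ₂) where

  open HeytingField K using (Carrier; 1#; _*_)

  ring : Ring c ℓ₁
  ring = CommutativeRing.ring
    (HeytingCommutativeRing.commutativeRing (HeytingField.heytingCommutativeRing K))

  private
    module F₁ = FreeModule ring _≟_
    module F₂ = FreeModule ring (×-≡-dec _≟_ _≟_)

  FQSym : LeftModule ring c ℓ₁
  FQSym = F₁.leftModule

  -- FQSym ⊗ FQSym, the pair (σ , τ) standing for 𝐅 σ ⊗ 𝐅 τ
  FQSym⊗FQSym : LeftModule ring c ℓ₁
  FQSym⊗FQSym = F₂.leftModule

  open LeftModule FQSym public using (Carrierᴹ; _≈ᴹ_; _*ₗ_; rawLeftModule)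
  open LeftModule FQSym⊗FQSym public using () renaming (Carrierᴹ to Carrierᴹ²)

  infixl 7 _⊗_ _∙_

  _⊗_ : Carrierᴹ → Carrierᴹ → Carrierᴹ²
  _⊗_ = cartesianProductWith λ (k , σ) (l , τ) → k * l , (σ , τ)

  𝐅 : 𝔖 → Carrierᴹ
  𝐅 σ = [ 1# , σ ]

  ∑𝐅 : List 𝔖 → Carrierᴹ
  ∑𝐅 = map (1# ,_)

  μ : Carrierᴹ² → Carrierᴹ
  μ = linearCombination FQSym λ (σ , ν) → ∑𝐅 (σ ⧢̅ ν)

  _∙_ : Carrierᴹ → Carrierᴹ → Carrierᴹ
  x ∙ y = μ (x ⊗ y)

  𝟏 : Carrierᴹ
  𝟏 = 𝐅 ∅

  Δ : Carrierᴹ → Carrierᴹ²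
  Δ = linearCombination FQSym⊗FQSym λ σ →
    map (λ k → 1# , (Std (take k (word σ)) , Std (drop k (word σ)))) (upTo (suc (size σ)))

  -- The counit is the projection onto the component of degree 0.
  counit : Carrierᴹ → Carrier
  counit = F₁.coeff ∅

  infixr 7 _⟨⊗⟩_

  _⟨⊗⟩_ : (f g : Carrierᴹ → Carrierᴹ) → Carrierᴹ² → Carrierᴹ²
  f ⟨⊗⟩ g = linearCombination FQSym⊗FQSym λ (σ , τ) → f (𝐅 σ) ⊗ g (𝐅 τ)

  open LeftModuleMorphisms rawLeftModule rawLeftModule using (IsLeftModuleHomomorphism)

  record IsAntipode (S : Carrierᴹ → Carrierᴹ) : Set (c ⊔ ℓ₁) where
    field
      isLinear : IsLeftModuleHomomorphism S
      inverseˡ : ∀ x → μ ((S ⟨⊗⟩ id) (Δ x)) ≈ᴹ counit x *ₗ 𝟏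
      inverseʳ : ∀ x → μ ((id ⟨⊗⟩ S) (Δ x)) ≈ᴹ counit x *ₗ 𝟏

  -- Over a field V ⊗ V embeds into FQSym ⊗ FQSym; this is its image.
  _⊗²  : ∀ {p} → Pred Carrierᴹ p → Pred Carrierᴹ² _
  V ⊗² = Span FQSym⊗FQSym {I = Σ Carrierᴹ V × Σ Carrierᴹ V} λ ((x , _) , (y , _)) → x ⊗ y

  -- Being graded and connected, FQSym has exactly one antipode, so that the
  -- quantifier in S-closed ranges over that one only.
  record IsHopfSubalgebra {p} (V : Pred Carrierᴹ p) : Set (c ⊔ ℓ₁ ⊔ p) where
    field
      isSubspace : IsSubspace FQSym V
      𝟏-closed   : V 𝟏
      ∙-closed   : ∀ {x y} → V x → V y → V (x ∙ y)
      Δ-closed   : ∀ {x} → V x → (V ⊗²) (Δ x)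
      S-closed   : ∀ {S} → IsAntipode S → ∀ {x} → V x → V (S x)

  -- A permutation of size n is sent by P to trees with n nodes, so that the
  -- sum ranges over all σ with P σ ≡ trees J.
  𝐏 : TwinPair → Carrierᴹ
  𝐏 J = ∑𝐅 (filter (λ σ → P σ ≟ᴾ trees J) 𝔖[ #nodes (TwinPair.left J) ])

  Baxter : Pred Carrierᴹ (c ⊔ ℓ₁)
  Baxter = Span FQSym 𝐏

{-# OPTIONS --safe #-}
module Submission where

-- A linear combination of the 𝐅 σ belongs to Baxter exactly when its
-- coefficients are constant on the fibres of P. Writing bst w for the tree
-- obtained by inserting w from right to left, P σ amounts to the labelled trees
-- of σ and of its mirror image, and bst (u ++ v) is a function of bst u and
-- bst v, while restricting a word to the letters below (or above) a bound prunes
-- its tree. The fibres of P are therefore compatible with concatenation and with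
-- restriction to intervals of letters, which govern the coefficients of Δ x and
-- of x ∙ y respectively. The antipode preserves Baxter by induction on the
-- degree, since S ⋆ id = η ε determines S x from S on smaller degrees.

open import Defs
open import Algebra.Apartness.Bundles using (HeytingField; HeytingCommutativeRing)
open import Algebra.Bundles using (CommutativeRing)
open import Algebra.Module.Bundles using (LeftModule)
open import Algebra.Module.Morphism.Structures using (module LeftModuleMorphisms)
open import Level using (Level; 0ℓ)
open import Function.Base using (_∘_; id; case_of_)
open import Function.Bundles using (_⇔_; mk⇔; Equivalence)
open import Data.Unit.Base using (⊤; tt)
open import Data.Bool.Base using (Bool; true; false; if_then_else_)
open import Data.Sum.Base using (_⊎_; inj₁; inj₂; [_,_]′)
open import Data.Product.Base using (∃; ∃₂; _×_; _,_; proj₁; proj₂)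
open import Data.Product.Properties using () renaming (≡-dec to ×-≡-dec)
open import Data.Fin.Patterns using (0F; 1F)
open import Data.Fin.Base using (Fin)
open import Data.Nat.Base using (ℕ; zero; suc; _+_; _∸_; _⊔_; _≤_; _<_; z≤n; s≤s)
open import Data.Nat.Properties as ℕₚ using (_<?_)
open import Data.List.Base
  using (List; []; _∷_; [_]; _++_; _∷ʳ_; map; length; filter; mapMaybe; take; drop;
         upTo; applyUpTo; foldr; reverse; deduplicate)
open import Data.List.Properties as Listₚ using (length-map; length-++)
open import Data.List.Membership.Propositional using (_∈_; _∉_; find; lose)
import Data.List.Membership.Propositional.Properties as ∈ₚ
open import Data.List.Relation.Unary.All as All using (All; []; _∷_)
import Data.List.Relation.Unary.All.Properties as Allₚ
open import Data.List.Relation.Unary.Any as Any using (Any; here; there)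
import Data.List.Relation.Unary.Any.Properties as Anyₚ
open import Data.List.Relation.Unary.AllPairs as AllPairs using (AllPairs; []; _∷_)
import Data.List.Relation.Unary.AllPairs.Properties as AllPairsₚ
open import Data.List.Relation.Unary.Unique.Propositional using (Unique)
import Data.List.Relation.Unary.Unique.Propositional.Properties as Uniqueₚ
open import Data.List.Relation.Unary.Sorted.TotalOrder.Properties using (↗↭↗⇒≋; AllPairs⇒Sorted)
open import Data.List.Relation.Binary.Pointwise using (Pointwise; []; _∷_; Pointwise-≡⇒≡)
open import Data.List.Relation.Binary.Permutation.Propositional
  using (_↭_; ↭-refl; ↭-reflexive; ↭-sym; ↭-trans; prep; swap; ↭⇒↭ₛ; module PermutationReasoning)
open import Data.List.Relation.Binary.Permutation.Propositional.Properties as ↭ₚ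
  using (↭-length; ∈-resp-↭; All-resp-↭; filter-↭; shift; ↭-reverse)
import Data.List.Relation.Binary.Permutation.Setoid.Properties as ↭ₛ
open import Data.Maybe.Base using (just; nothing)
import Data.Maybe.Relation.Unary.Any as MAny
open import Data.Tree.Binary using (Tree; leaf; node; #nodes) renaming (map to mapᵀ)
open import Relation.Nullary using (¬_; Dec; yes; no; does; contradiction; contradiction-irr; recompute; ¬?)
open import Relation.Nullary.Decidable using (map′; _×-dec_; dec-true; dec-false)
open import Relation.Unary using (Pred; Decidable)
open import Relation.Binary.Definitions using (DecidableEquality)
import Relation.Binary.Reasoning.Setoid as SetoidReasoning
open import Relation.Binary.PropositionalEquality
  using (_≡_; _≢_; refl; sym; trans; cong; cong₂; subst; subst₂; setoid; module ≡-Reasoning)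

-- Invariance on fibres is a workable criterion because elements have finite support: a coefficient
-- function constant on the fibres of `P` is a finite sum of fibre indicators, and every fibre is
-- indexed by a twin pair. Closure under an operation then becomes an identity between coefficients.
-- For the product it holds term by term. For the coproduct it does not: equivalent pairs (σ , τ)
-- and (σ′ , τ′) arise from different permutations, which have to be matched by a bijection keeping
-- the letters of each factor. `P` forgets labels, whereas concatenation needs them. They are
-- recovered because a search tree is determined by its shape and its letters; so words with the
-- same letters are compared through labelled trees, and standardization enters only through its
-- preserving the order of those letters. For the antipode, S (𝐅 σ) need not be invariant for a
-- single σ, so the induction may use S on the 𝐏 J only: the proper part of Δ x is first rewritten
-- as a combination of tensors 𝐏 J ⊗ 𝐏 J′.

private
  variable
    A B : Set
    u v w : Word

-- Binary search trees

bst : Word → Tree ℕ ⊤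
bst = foldr insert (leaf tt)

-- The split of a search tree along the search path of m: subtrees hanging off the path are kept or
-- discarded whole.
below above : ℕ → Tree ℕ ⊤ → Tree ℕ ⊤
below m (leaf _) = leaf tt
below m (node l y r) with y <? m
... | yes _ = node l y (below m r)
... | no  _ = below m l
above m (leaf _) = leaf tt
above m (node l y r) with y <? m
... | yes _ = above m r
... | no  _ = node (above m l) y r

module _ {x y : ℕ} where

  insert-< : x < y → ∀ l r → insert x (node l y r) ≡ node (insert x l) y r
  insert-< x<y l r with x <? y
  ... | yes _   = refl
  ... | no  x≮y = contradiction x<y x≮y

  insert-≮ : ¬ x < y → ∀ l r → insert x (node l y r) ≡ node l y (insert x r)
  insert-≮ x≮y l r with x <? y
  ... | yes x<y = contradiction x<y x≮y
  ... | no  _   = refl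

  below-< : x < y → ∀ l r → below y (node l x r) ≡ node l x (below y r)
  below-< x<y l r with x <? y
  ... | yes _   = refl
  ... | no  x≮y = contradiction x<y x≮y

  below-≮ : ¬ x < y → ∀ l r → below y (node l x r) ≡ below y l
  below-≮ x≮y l r with x <? y
  ... | yes x<y = contradiction x<y x≮y
  ... | no  _   = refl

  above-< : x < y → ∀ l r → above y (node l x r) ≡ above y r
  above-< x<y l r with x <? y
  ... | yes _   = refl
  ... | no  x≮y = contradiction x<y x≮y

  above-≮ : ¬ x < y → ∀ l r → above y (node l x r) ≡ node (above y l) x r
  above-≮ x≮y l r with x <? y
  ... | yes x<y = contradiction x<y x≮y
  ... | no  _   = refl

-- At each node either x and m descend to the same side, or x enters a left subtree that is kept
-- whole. When x is not below m, the second alternative becomes a right subtree that is discarded.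
below-insert-< : ∀ {x m} → x < m → ∀ T → below m (insert x T) ≡ insert x (below m T)
below-insert-< x<m (leaf _) = below-< x<m _ _
below-insert-< {x} {m} x<m (node l y r) with x <? y | y <? m
... | yes x<y | yes y<m = trans (below-< y<m _ _) (sym (insert-< x<y _ _))
... | yes x<y | no  y≮m = trans (below-≮ y≮m _ _) (below-insert-< x<m l)
... | no  x≮y | yes y<m = trans (below-< y<m _ _)
  (trans (cong (node l y) (below-insert-< x<m r)) (sym (insert-≮ x≮y _ _)))
... | no  x≮y | no  y≮m = contradiction (ℕₚ.<-≤-trans x<m (ℕₚ.≮⇒≥ y≮m)) x≮y

below-insert-≮ : ∀ {x m} → ¬ x < m → ∀ T → below m (insert x T) ≡ below m T
below-insert-≮ x≮m (leaf _) = below-≮ x≮m _ _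
below-insert-≮ {x} {m} x≮m (node l y r) with x <? y | y <? m
... | yes x<y | yes y<m = contradiction (ℕₚ.<-trans x<y y<m) x≮m
... | yes x<y | no  y≮m = trans (below-≮ y≮m _ _) (below-insert-≮ x≮m l)
... | no  x≮y | yes y<m = trans (below-< y<m _ _) (cong (node l y) (below-insert-≮ x≮m r))
... | no  x≮y | no  y≮m = below-≮ y≮m _ _

above-insert-< : ∀ {x m} → x < m → ∀ T → above m (insert x T) ≡ above m T
above-insert-< x<m (leaf _) = above-< x<m _ _
above-insert-< {x} {m} x<m (node l y r) with x <? y | y <? m
... | yes x<y | yes y<m = above-< y<m _ _
... | yes x<y | no  y≮m = trans (above-≮ y≮m _ _) (cong (λ t → node t y r) (above-insert-< x<m l))
... | no  x≮y | yes y<m = trans (above-< y<m _ _) (above-insert-< x<m r)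
... | no  x≮y | no  y≮m = contradiction (ℕₚ.<-≤-trans x<m (ℕₚ.≮⇒≥ y≮m)) x≮y

above-insert-≮ : ∀ {x m} → ¬ x < m → ∀ T → above m (insert x T) ≡ insert x (above m T)
above-insert-≮ x≮m (leaf _) = above-≮ x≮m _ _
above-insert-≮ {x} {m} x≮m (node l y r) with x <? y | y <? m
... | yes x<y | yes y<m = contradiction (ℕₚ.<-trans x<y y<m) x≮m
... | yes x<y | no  y≮m = trans (above-≮ y≮m _ _)
  (trans (cong (λ t → node t y r) (above-insert-≮ x≮m l)) (sym (insert-< x<y _ _)))
... | no  x≮y | yes y<m = trans (above-< y<m _ _) (above-insert-≮ x≮m r)
... | no  x≮y | no  y≮m = trans (above-≮ y≮m _ _) (sym (insert-≮ x≮y _ _))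

bst-filter-< : ∀ m w → bst (filter (_<? m) w) ≡ below m (bst w)
bst-filter-< m []      = refl
bst-filter-< m (x ∷ w) with x <? m
... | yes x<m = trans (cong bst (Listₚ.filter-accept (_<? m) x<m))
  (trans (cong (insert x) (bst-filter-< m w)) (sym (below-insert-< x<m (bst w))))
... | no  x≮m = trans (cong bst (Listₚ.filter-reject (_<? m) x≮m))
  (trans (bst-filter-< m w) (sym (below-insert-≮ x≮m (bst w))))

bst-filter-≮ : ∀ m w → bst (filter (¬? ∘ (_<? m)) w) ≡ above m (bst w)
bst-filter-≮ m []      = refl
bst-filter-≮ m (x ∷ w) with x <? m
... | yes x<m = trans (cong bst (Listₚ.filter-reject (¬? ∘ (_<? m)) λ x≮m → x≮m x<m))
  (trans (bst-filter-≮ m w) (sym (above-insert-< x<m (bst w))))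
... | no  x≮m = trans (cong bst (Listₚ.filter-accept (¬? ∘ (_<? m)) x≮m))
  (trans (cong (insert x) (bst-filter-≮ m w)) (sym (above-insert-≮ x≮m (bst w))))

-- The leaf of T that delimits an interval of values receives the letters of
-- that interval.
merge : Tree ℕ ⊤ → Tree ℕ ⊤ → Tree ℕ ⊤
merge (leaf _)     S = S
merge (node l y r) S = node (merge l (below y S)) y (merge r (above y S))

merge-leaf : ∀ T → merge T (leaf tt) ≡ T
merge-leaf (leaf _)     = refl
merge-leaf (node l y r) = cong₂ (λ l r → node l y r) (merge-leaf l) (merge-leaf r)

insert-merge : ∀ x T S → insert x (merge T S) ≡ merge T (insert x S)
insert-merge x (leaf _)     S = refl
insert-merge x (node l y r) S with x <? y
... | yes x<y = cong₂ (λ l r → node l y r)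
  (trans (insert-merge x l _) (cong (merge l) (sym (below-insert-< x<y S))))
  (cong (merge r) (sym (above-insert-< x<y S)))
... | no  x≮y = cong₂ (λ l r → node l y r)
  (cong (merge l) (sym (below-insert-≮ x≮y S)))
  (trans (insert-merge x r _) (cong (merge r) (sym (above-insert-≮ x≮y S))))

-- The letters of v are inserted first. Each leaf of `bst v` then receives a restriction of u to an
-- interval of values, in the original order, and the tree of such a restriction is a pruning of
-- `bst u`; so u matters only through its tree.
bst-++ : ∀ u v → bst (u ++ v) ≡ merge (bst v) (bst u)
bst-++ []      v = sym (merge-leaf (bst v))
bst-++ (x ∷ u) v = trans (cong (insert x) (bst-++ u v)) (insert-merge x (bst v) (bst u))

-- Words with the same pair of labelled search trees

infix 4 _∼_

-- The Baxter congruence, on words without repeated letters. Labels are kept because `merge`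
-- compares them: equality of shapes alone would not be stable under concatenation.
record _∼_ (u v : Word) : Set where
  constructor mk∼
  field
    bst-≡         : bst u ≡ bst v
    bst-reverse-≡ : bst (reverse u) ≡ bst (reverse v)

filter-reverse : ∀ {p} {P : Pred A p} (P? : Decidable P) xs → filter P? (reverse xs) ≡ reverse (filter P? xs)
filter-reverse P? []       = refl
filter-reverse P? (x ∷ xs) = begin
  filter P? (reverse (x ∷ xs))                ≡⟨ cong (filter P?) (Listₚ.unfold-reverse x xs) ⟩
  filter P? (reverse xs ∷ʳ x)                 ≡⟨ Listₚ.filter-++ P? (reverse xs) [ x ] ⟩
  filter P? (reverse xs) ++ filter P? [ x ]   ≡⟨ cong₂ _++_ (filter-reverse P? xs) (sym reverse-[x]) ⟩
  reverse (filter P? xs) ++ reverse (filter P? [ x ])  ≡⟨ Listₚ.reverse-++ (filter P? [ x ]) (filter P? xs) ⟨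
  reverse (filter P? [ x ] ++ filter P? xs)   ≡⟨ cong reverse (Listₚ.filter-++ P? [ x ] xs) ⟨
  reverse (filter P? (x ∷ xs))                ∎
  where
  open ≡-Reasoning
  reverse-[x] : reverse (filter P? [ x ]) ≡ filter P? [ x ]
  reverse-[x] with does (P? x)
  ... | true  = refl
  ... | false = refl

∼-++ : ∀ {u u′ v v′} → u ∼ u′ → v ∼ v′ → u ++ v ∼ u′ ++ v′
∼-++ {u} {u′} {v} {v′} (mk∼ p p′) (mk∼ q q′) = mk∼ (step u u′ v v′ p q) (begin
  bst (reverse (u ++ v))           ≡⟨ cong bst (Listₚ.reverse-++ u v) ⟩
  bst (reverse v ++ reverse u)     ≡⟨ step (reverse v) (reverse v′) (reverse u) (reverse u′) q′ p′ ⟩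
  bst (reverse v′ ++ reverse u′)   ≡⟨ cong bst (Listₚ.reverse-++ u′ v′) ⟨
  bst (reverse (u′ ++ v′))         ∎)
  where
  open ≡-Reasoning
  step : ∀ u u′ v v′ → bst u ≡ bst u′ → bst v ≡ bst v′ → bst (u ++ v) ≡ bst (u′ ++ v′)
  step u u′ v v′ p q = trans (bst-++ u v) (trans (cong₂ merge q p) (sym (bst-++ u′ v′)))

module _ {p} {P : Pred ℕ p} (P? : Decidable P) (prune : Tree ℕ ⊤ → Tree ℕ ⊤)
         (bst-filter : ∀ w → bst (filter P? w) ≡ prune (bst w)) where

  ∼-filter : ∀ {u v} → u ∼ v → filter P? u ∼ filter P? v
  ∼-filter {u} {v} (mk∼ p p′) = mk∼ (step u v p) (begin
    bst (reverse (filter P? u))  ≡⟨ cong bst (filter-reverse P? u) ⟨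
    bst (filter P? (reverse u))  ≡⟨ step (reverse u) (reverse v) p′ ⟩
    bst (filter P? (reverse v))  ≡⟨ cong bst (filter-reverse P? v) ⟩
    bst (reverse (filter P? v))  ∎)
    where
    open ≡-Reasoning
    step : ∀ u v → bst u ≡ bst v → bst (filter P? u) ≡ bst (filter P? v)
    step u v p = trans (bst-filter u) (trans (cong prune p) (sym (bst-filter v)))

-- Recovering labels from shapes

inorder : ∀ {N L : Set} → Tree N L → List N
inorder (leaf _)     = []
inorder (node l y r) = inorder l ++ y ∷ inorder r

inorder-insert : ∀ x T → inorder (insert x T) ↭ x ∷ inorder T
inorder-insert x (leaf _)     = ↭-refl
inorder-insert x (node l y r) with x <? y
... | yes _ = ↭ₚ.++⁺ʳ (y ∷ inorder r) (inorder-insert x l)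
... | no  _ = begin
  inorder l ++ y ∷ inorder (insert x r)  ↭⟨ ↭ₚ.++⁺ˡ (inorder l) (prep y (inorder-insert x r)) ⟩
  inorder l ++ y ∷ x ∷ inorder r         ↭⟨ ↭ₚ.++⁺ˡ (inorder l) (swap y x ↭-refl) ⟩
  inorder l ++ x ∷ y ∷ inorder r         ↭⟨ shift x (inorder l) (y ∷ inorder r) ⟩
  x ∷ inorder l ++ y ∷ inorder r         ∎
  where open PermutationReasoning

inorder-bst : ∀ w → inorder (bst w) ↭ w
inorder-bst []      = ↭-refl
inorder-bst (x ∷ w) = ↭-trans (inorder-insert x (bst w)) (prep x (inorder-bst w))

AllPairs-++⁻ : ∀ {R : ℕ → ℕ → Set} xs {ys} → AllPairs R (xs ++ ys) →
               AllPairs R xs × AllPairs R ys × All (λ x → All (R x) ys) xs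
AllPairs-++⁻ []       pys       = [] , pys , []
AllPairs-++⁻ (x ∷ xs) (px ∷ ps) with AllPairs-++⁻ xs ps
... | pxs , pys , pxys = Allₚ.++⁻ˡ xs px ∷ pxs , pys , Allₚ.++⁻ʳ xs px ∷ pxys

insert-sorted : ∀ x T → AllPairs _≤_ (inorder T) → AllPairs _≤_ (inorder (insert x T))
insert-sorted x (leaf _)     _ = [] ∷ []
insert-sorted x (node l y r) s with AllPairs-++⁻ (inorder l) s | x <? y
... | sl , y≤r ∷ sr , l≤ | yes x<y = AllPairsₚ.++⁺ (insert-sorted x l sl) (y≤r ∷ sr)
  (All-resp-↭ (↭-sym (inorder-insert x l))
    ((ℕₚ.<⇒≤ x<y ∷ All.map (ℕₚ.≤-trans (ℕₚ.<⇒≤ x<y)) y≤r) ∷ l≤))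
... | sl , y≤r ∷ sr , l≤ | no x≮y = AllPairsₚ.++⁺ sl
  (All-resp-↭ (↭-sym (inorder-insert x r)) (ℕₚ.≮⇒≥ x≮y ∷ y≤r) ∷ insert-sorted x r sr)
  (All.map (λ { (a≤y ∷ a≤r) → a≤y ∷ All-resp-↭ (↭-sym (inorder-insert x r))
                                     (ℕₚ.≤-trans a≤y (ℕₚ.≮⇒≥ x≮y) ∷ a≤r) }) l≤)

bst-sorted : ∀ w → AllPairs _≤_ (inorder (bst w))
bst-sorted []      = []
bst-sorted (x ∷ w) = insert-sorted x (bst w) (bst-sorted w)

sorted-↭⇒≡ : AllPairs _≤_ u → AllPairs _≤_ v → u ↭ v → u ≡ v
sorted-↭⇒≡ su sv p = Pointwise-≡⇒≡
  (↗↭↗⇒≋ ℕₚ.≤-totalOrder (AllPairs⇒Sorted ℕₚ.≤-totalOrder su) (AllPairs⇒Sorted ℕₚ.≤-totalOrder sv) (↭⇒↭ₛ p))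

#nodes-shape : ∀ T → #nodes (shape T) ≡ length (inorder T)
#nodes-shape (leaf _)     = refl
#nodes-shape (node l y r) = trans (cong₂ (λ m n → m + suc n) (#nodes-shape l) (#nodes-shape r))
                                  (sym (length-++ (inorder l)))

#nodes-shape-bst : ∀ w → #nodes (shape (bst w)) ≡ length w
#nodes-shape-bst w = trans (#nodes-shape (bst w)) (↭-length (inorder-bst w))

++-injective : ∀ (a b : List A) {c d} → length a ≡ length b → a ++ c ≡ b ++ d → a ≡ b × c ≡ d
++-injective []      []      _ q = refl , q
++-injective (x ∷ a) (y ∷ b) p q with Listₚ.∷-injective q
... | x≡y , q′ with ++-injective a b (ℕₚ.suc-injective p) q′
...   | a≡b , c≡d = cong₂ _∷_ x≡y a≡b , c≡d

-- The shape gives the size of the left subtree, hence the place where the inorder list has to be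
-- cut.
shape-inorder-injective : ∀ T U → shape T ≡ shape U → inorder T ≡ inorder U → T ≡ U
shape-inorder-injective (leaf _)     (leaf _)        _ _ = refl
shape-inorder-injective (leaf _)     (node _ _ _)    () _
shape-inorder-injective (node _ _ _) (leaf _)        () _
shape-inorder-injective (node l y r) (node l′ y′ r′) p q
  with ++-injective (inorder l) (inorder l′)
         (trans (sym (#nodes-shape l)) (trans (cong (#nodes ∘ left) p) (#nodes-shape l′))) q
  where
  left : BinaryTree → BinaryTree
  left (leaf _)     = leaf tt
  left (node l _ _) = l
... | ql , q′ with Listₚ.∷-injective q′
...   | refl , qr with shape-inorder-injective l l′ (node-injectiveˡ p) ql | shape-inorder-injective r r′ (node-injectiveʳ p) qr
  where
  node-injectiveˡ : ∀ {l l′ r r′ : BinaryTree} → node l tt r ≡ node l′ tt r′ → l ≡ l′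
  node-injectiveˡ refl = refl
  node-injectiveʳ : ∀ {l l′ r r′ : BinaryTree} → node l tt r ≡ node l′ tt r′ → r ≡ r′
  node-injectiveʳ refl = refl
...     | refl | refl = refl

-- The counterpart of `P` for arbitrary words. Reversal turns insertion from the left into `bst`, so
-- that each fact about `bst` serves both trees.
shapes : Word → BinaryTree × BinaryTree
shapes w = shape (bst (reverse w)) , shape (bst w)

P≡shapes : ∀ σ → P σ ≡ shapes (word σ)
P≡shapes σ = cong (λ T → shape T , shape (bst (word σ))) (sym (Listₚ.reverse-foldr insert (leaf tt) (word σ)))

∼⇒shapes : u ∼ v → shapes u ≡ shapes v
∼⇒shapes (mk∼ p q) = cong₂ _,_ (cong shape q) (cong shape p)

-- Search trees on the same letters have the same sorted inorder list, so only their shapes can tell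
-- them apart.
shapes⇒∼ : u ↭ v → shapes u ≡ shapes v → u ∼ v
shapes⇒∼ {u} {v} u↭v p = mk∼ (step u↭v (cong proj₂ p))
  (step (↭-trans (↭-reverse u) (↭-trans u↭v (↭-sym (↭-reverse v)))) (cong proj₁ p))
  where
  step : ∀ {u v} → u ↭ v → shape (bst u) ≡ shape (bst v) → bst u ≡ bst v
  step {u} {v} u↭v p = shape-inorder-injective (bst u) (bst v) p
    (sorted-↭⇒≡ (bst-sorted u) (bst-sorted v)
      (↭-trans (inorder-bst u) (↭-trans u↭v (↭-sym (inorder-bst v)))))

-- Insertion compares letters of the word only. The restriction to them matters: `rank u`, the map
-- in view, is not injective on all of ℕ.
OrderEmbeddingOn : Word → (ℕ → ℕ) → Set
OrderEmbeddingOn w f = ∀ {x y} → x ∈ w → y ∈ w → x < y ⇔ f x < f y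

insert-map : ∀ {f x} T → All (λ y → x < y ⇔ f x < f y) (inorder T) →
             insert (f x) (mapᵀ f id T) ≡ mapᵀ f id (insert x T)
insert-map (leaf _) _ = refl
insert-map {f} {x} (node l y r) ps with Allₚ.++⁻ˡ (inorder l) ps | Allₚ.++⁻ʳ (inorder l) ps | x <? y
... | pl | p ∷ pr | yes x<y = trans (insert-< (Equivalence.to p x<y) _ _)
  (cong (λ t → node t (f y) (mapᵀ f id r)) (insert-map l pl))
... | pl | p ∷ pr | no x≮y = trans (insert-≮ (x≮y ∘ Equivalence.from p) _ _)
  (cong (node (mapᵀ f id l) (f y)) (insert-map r pr))

bst-map : ∀ {f} w → OrderEmbeddingOn w f → bst (map f w) ≡ mapᵀ f id (bst w)
bst-map []          e = refl
bst-map {f} (x ∷ w) e = trans (cong (insert (f x)) (bst-map w λ p q → e (there p) (there q)))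
  (insert-map (bst w) (All.tabulate λ y∈ → e (here refl) (there (∈-resp-↭ (inorder-bst w) y∈))))

shape-map : ∀ (f : ℕ → ℕ) T → shape (mapᵀ f id T) ≡ shape T
shape-map f (leaf _)     = refl
shape-map f (node l y r) = cong₂ (λ l r → node l tt r) (shape-map f l) (shape-map f r)

shapes-map : ∀ {f} w → OrderEmbeddingOn w f → shapes (map f w) ≡ shapes w
shapes-map {f} w e = cong₂ _,_
  (trans (cong (shape ∘ bst) (sym (Listₚ.reverse-map f w)))
    (step (reverse w) λ p q → e (∈-resp-↭ (↭-reverse w) p) (∈-resp-↭ (↭-reverse w) q)))
  (step w e)
  where
  step : ∀ w → OrderEmbeddingOn w f → shape (bst (map f w)) ≡ shape (bst w)
  step w e = trans (cong shape (bst-map w e)) (shape-map f (bst w))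

-- Standardization

unique-resp-↭ : Unique u → u ↭ v → Unique v
unique-resp-↭ p q = ↭ₛ.Unique-resp-↭ (setoid ℕ) (↭⇒↭ₛ q) p

rank : Word → ℕ → ℕ
rank u x = suc (#smaller x u)

#smaller-strict : ∀ {x y} → x ∈ u → x < y → #smaller x u < #smaller y u
#smaller-strict {u = z ∷ u} {x} {y} x∈u x<y = go x∈u (z <? x) (z <? y)
  where
  go : x ∈ z ∷ u → Dec (z < x) → Dec (z < y) → #smaller x (z ∷ u) < #smaller y (z ∷ u)
  go (here refl) (yes x<x) _         = contradiction x<x (ℕₚ.<-irrefl refl)
  go (here refl) (no  z≮x) (yes z<y) = subst₂ _<_ (sym (#smaller-reject z≮x u)) (sym (#smaller-accept z<y u))
                                         (s≤s (#smaller-mono (ℕₚ.<⇒≤ x<y) u))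
  go (here refl) _         (no  x≮y) = contradiction x<y x≮y
  go (there _)   (yes z<x) (no  z≮y) = contradiction (ℕₚ.<-trans z<x x<y) z≮y
  go (there p)   (yes z<x) (yes z<y) = subst₂ _<_ (sym (#smaller-accept z<x u)) (sym (#smaller-accept z<y u))
                                         (s≤s (#smaller-strict p x<y))
  go (there p)   (no  z≮x) (yes z<y) = subst₂ _<_ (sym (#smaller-reject z≮x u)) (sym (#smaller-accept z<y u))
                                         (ℕₚ.m<n⇒m<1+n (#smaller-strict p x<y))
  go (there p)   (no  z≮x) (no  z≮y) = subst₂ _<_ (sym (#smaller-reject z≮x u)) (sym (#smaller-reject z≮y u))
                                         (#smaller-strict p x<y)

rank-embedding : ∀ u → OrderEmbeddingOn u (rank u)
rank-embedding u {x} {y} x∈u y∈u = mk⇔ (λ x<y → s≤s (#smaller-strict x∈u x<y))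
  λ { (s≤s r) → ℕₚ.≰⇒> λ y≤x → ℕₚ.<⇒≱ r (#smaller-mono y≤x u) }

rank-injective : ∀ {x y} → x ∈ u → y ∈ u → rank u x ≡ rank u y → x ≡ y
rank-injective {u} x∈u y∈u p = ℕₚ.≤-antisym
  (ℕₚ.≮⇒≥ λ y<x → ℕₚ.<⇒≢ (Equivalence.to (rank-embedding u y∈u x∈u) y<x) (sym p))
  (ℕₚ.≮⇒≥ λ x<y → ℕₚ.<⇒≢ (Equivalence.to (rank-embedding u x∈u y∈u) x<y) p)

rank-↭ : u ↭ v → ∀ x → rank u x ≡ rank v x
rank-↭ p x = cong suc (↭-length (filter-↭ (_<? x) p))

-- Prepending x raises by one the ranks of the letters larger than x, and these are the letters
-- whose rank in u exceeds `suc (#smaller x u)` or equals it.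
bump-rank : ∀ {x y} → y ∈ u → x ≢ y → bump (#smaller x u) (rank u y) ≡ rank (x ∷ u) y
bump-rank {u} {x} {y} y∈u x≢y with bump (#smaller x u) (rank u y) | bump-cases (#smaller x u) (rank u y) | x <? y
... | _ | inj₁ (le , refl) | yes x<y = contradiction le (ℕₚ.≤⇒≯ (#smaller-mono (ℕₚ.<⇒≤ x<y) u))
... | _ | inj₁ (_  , refl) | no  x≮y = cong suc (sym (#smaller-reject x≮y u))
... | _ | inj₂ (_  , refl) | yes x<y = cong suc (sym (#smaller-accept x<y u))
... | _ | inj₂ (gt , refl) | no  x≮y = contradiction gt
  (ℕₚ.≤⇒≯ (#smaller-strict y∈u (ℕₚ.≤∧≢⇒< (ℕₚ.≮⇒≥ x≮y) (x≢y ∘ sym))))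

-- Trades the recursion of `std` for a letterwise map by a function that depends only on the set of
-- letters, see `rank-↭`. Equal letters would spoil this, since `std` gives them different values.
std≡map-rank : Unique u → std u ≡ map (rank u) u
std≡map-rank {[]}    _          = refl
std≡map-rank {x ∷ u} (x∉u ∷ uu) = cong₂ _∷_ (cong suc (sym (#smaller-reject (ℕₚ.<-irrefl refl) u))) (begin
  map (bump k) (std u)           ≡⟨ cong (map (bump k)) (std≡map-rank uu) ⟩
  map (bump k) (map (rank u) u)  ≡⟨ Listₚ.map-∘ u ⟨
  map (bump k ∘ rank u) u        ≡⟨ Listₚ.map-cong-local (All.tabulate λ y∈u → bump-rank y∈u (All.lookup x∉u y∈u)) ⟩
  map (rank (x ∷ u)) u           ∎)
  where
  open ≡-Reasoning
  k = #smaller x u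

[1⋯]-unique : ∀ n → Unique [1⋯ n ]
[1⋯]-unique n = Uniqueₚ.applyUpTo⁺₁ suc n λ i<j _ p → ℕₚ.<⇒≢ i<j (ℕₚ.suc-injective p)

isPermutation⇒unique : IsPermutation w → Unique w
isPermutation⇒unique p = unique-resp-↭ ([1⋯]-unique _) (↭-sym p)

filter-< : ∀ m k → filter (_<? suc m) [1⋯ m + k ] ≡ [1⋯ m ]
filter-< m k = begin
  filter (_<? suc m) [1⋯ m + k ]                                             ≡⟨ cong (filter (_<? suc m)) ([1⋯]-+ m k) ⟨
  filter (_<? suc m) ([1⋯ m ] ++ shiftBy m [1⋯ k ])                          ≡⟨ Listₚ.filter-++ (_<? suc m) [1⋯ m ] _ ⟩
  filter (_<? suc m) [1⋯ m ] ++ filter (_<? suc m) (shiftBy m [1⋯ k ])       ≡⟨ cong₂ _++_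
    (Listₚ.filter-all (_<? suc m) (Allₚ.applyUpTo⁺₁ suc m s≤s))
    (Listₚ.filter-none (_<? suc m) (Allₚ.map⁺ (Allₚ.applyUpTo⁺₂ suc k λ i → ℕₚ.≤⇒≯ (ℕₚ.m<m+n m (s≤s z≤n))))) ⟩
  [1⋯ m ] ++ []                                                              ≡⟨ Listₚ.++-identityʳ _ ⟩
  [1⋯ m ]                                                                    ∎
  where open ≡-Reasoning

filter-≮ : ∀ m k → filter (¬? ∘ (_<? suc m)) [1⋯ m + k ] ≡ shiftBy m [1⋯ k ]
filter-≮ m k = begin
  filter Q? [1⋯ m + k ]                                ≡⟨ cong (filter Q?) ([1⋯]-+ m k) ⟨
  filter Q? ([1⋯ m ] ++ shiftBy m [1⋯ k ])             ≡⟨ Listₚ.filter-++ Q? [1⋯ m ] _ ⟩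
  filter Q? [1⋯ m ] ++ filter Q? (shiftBy m [1⋯ k ])   ≡⟨ cong₂ _++_
    (Listₚ.filter-none Q? (Allₚ.applyUpTo⁺₁ suc m λ i<m ¬p → ¬p (s≤s i<m)))
    (Listₚ.filter-all Q? (Allₚ.map⁺ (Allₚ.applyUpTo⁺₂ suc k λ i → ℕₚ.≤⇒≯ (ℕₚ.m<m+n m (s≤s z≤n))))) ⟩
  shiftBy m [1⋯ k ]                                    ∎
  where
  open ≡-Reasoning
  Q? = ¬? ∘ (_<? suc m)

rank-[1⋯] : ∀ {i n} → i < n → rank [1⋯ n ] (suc i) ≡ suc i
rank-[1⋯] {i} {n} i<n = cong suc (begin
  #smaller (suc i) [1⋯ n ]              ≡⟨ cong (λ n → #smaller (suc i) [1⋯ n ]) (ℕₚ.m+[n∸m]≡n (ℕₚ.<⇒≤ i<n)) ⟨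
  #smaller (suc i) [1⋯ i + (n ∸ i) ]    ≡⟨ cong length (filter-< i (n ∸ i)) ⟩
  length [1⋯ i ]                        ≡⟨ Listₚ.length-applyUpTo suc i ⟩
  i                                     ∎)
  where open ≡-Reasoning

std-permutation : IsPermutation w → std w ≡ w
std-permutation {w} p = trans (std≡map-rank (isPermutation⇒unique p)) (Listₚ.map-id-local (All.tabulate fix))
  where
  fix : ∀ {x} → x ∈ w → rank w x ≡ x
  fix {x} x∈w with ∈ₚ.∈-applyUpTo⁻ suc (∈-resp-↭ p x∈w)
  ... | i , i<n , refl = trans (rank-↭ p x) (rank-[1⋯] i<n)

map-injective-on : ∀ {f : A → B} u v → (∀ {x y} → x ∈ u → y ∈ v → f x ≡ f y → x ≡ y) →
                   map f u ≡ map f v → u ≡ v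
map-injective-on []      []      _ _ = refl
map-injective-on (x ∷ u) (y ∷ v) e p with Listₚ.∷-injective p
... | q , r = cong₂ _∷_ (e (here refl) (here refl) q) (map-injective-on u v (λ x∈ y∈ → e (there x∈) (there y∈)) r)

-- Both standardizations apply the same rank function, which is injective on the common letters.
std-injective : Unique u → u ↭ v → std u ≡ std v → u ≡ v
std-injective {u} {v} uu p q = map-injective-on u v
  (λ x∈u y∈v → rank-injective x∈u (∈-resp-↭ (↭-sym p) y∈v)) (begin
    map (rank u) u  ≡⟨ std≡map-rank uu ⟨
    std u           ≡⟨ q ⟩
    std v           ≡⟨ std≡map-rank (unique-resp-↭ uu p) ⟩
    map (rank v) v  ≡⟨ Listₚ.map-cong (rank-↭ p) v ⟨
    map (rank u) v  ∎)
  where open ≡-Reasoning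

-- Since the values r x are distinct, the inverse can be assembled one letter at a time; off the
-- image the default `id` is arbitrary.
map-leftInverse : ∀ (r : ℕ → ℕ) u → Unique (map r u) → ∃ λ (f : ℕ → ℕ) → All (λ x → f (r x) ≡ x) u
map-leftInverse r []      _        = id , []
map-leftInverse r (x ∷ u) (p ∷ us) with map-leftInverse r u us
... | f , fs = g , g-here ∷ All.tabulate (λ {y} y∈u → g-there (All.lookup (Allₚ.map⁻ p) y∈u) (All.lookup fs y∈u))
  where
  g : ℕ → ℕ
  g i = if does (i ℕₚ.≟ r x) then x else f i
  g-here : g (r x) ≡ x
  g-here = cong (if_then x else f (r x)) (dec-true (r x ℕₚ.≟ r x) refl)
  g-there : ∀ {y} → r x ≢ r y → f (r y) ≡ y → g (r y) ≡ y
  g-there {y} rx≢ry e = trans (cong (if_then x else f (r y)) (dec-false (r y ℕₚ.≟ r x) (rx≢ry ∘ sym))) e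

isPermutation-↭ : ∀ {u v} → IsPermutation u → IsPermutation v → length u ≡ length v → u ↭ v
isPermutation-↭ p q e = ↭-trans p (↭-trans (↭-reflexive (cong [1⋯_] e)) (↭-sym q))

-- With f inverting `rank u`, the word is map f s: as `std u` and s are permutations of one size, it
-- rearranges map f (std u), which is u. This serves to exchange a factor of a permutation for an
-- equivalent one on the same letters.
destandardize : ∀ {s} → Unique u → IsPermutation s → length s ≡ length u → ∃ λ v → u ↭ v × std v ≡ s
destandardize {u} {s} uu ps e = u′ , u↭u′ , (begin
  std u′                    ≡⟨ std≡map-rank (unique-resp-↭ uu u↭u′) ⟩
  map (rank u′) u′          ≡⟨ Listₚ.map-cong (rank-↭ u↭u′) u′ ⟨
  map (rank u) (map f s)   ≡⟨ Listₚ.map-∘ s ⟨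
  map (rank u ∘ f) s       ≡⟨ Listₚ.map-id-local (All.tabulate fix) ⟩
  s                        ∎)
  where
  open ≡-Reasoning
  std≡ : std u ≡ map (rank u) u
  std≡ = std≡map-rank uu
  inverse = map-leftInverse (rank u) u (subst Unique std≡ (isPermutation⇒unique (std-isPermutation u)))
  f = proj₁ inverse
  u′ = map f s
  s↭std : s ↭ std u
  s↭std = isPermutation-↭ ps (std-isPermutation u) (trans e (sym (length-std u)))
  u↭u′ : u ↭ u′
  u↭u′ = ↭-sym (↭-trans (↭ₚ.map⁺ f s↭std) (↭-reflexive (begin
    map f (std u)            ≡⟨ cong (map f) std≡ ⟩
    map f (map (rank u) u)   ≡⟨ Listₚ.map-∘ u ⟨
    map (f ∘ rank u) u       ≡⟨ Listₚ.map-id-local (proj₂ inverse) ⟩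
    u                        ∎)))
  fix : ∀ {x} → x ∈ s → rank u (f x) ≡ x
  fix x∈s with ∈ₚ.∈-map⁻ (rank u) (subst (_ ∈_) std≡ (∈-resp-↭ s↭std x∈s))
  ... | z , z∈u , refl = cong (rank u) (All.lookup (proj₂ inverse) z∈u)

shapes-std : Unique u → shapes (std u) ≡ shapes u
shapes-std {u} uu = trans (cong shapes (std≡map-rank uu)) (shapes-map u (rank-embedding u))

-- The fibres of `P`

isPerm : ∀ σ → IsPermutation (word σ)
-- The stored proof is irrelevant; deciding the property rebuilds a usable one.
isPerm (perm w p) = recompute (isPermutation? w) p

unique : ∀ σ → Unique (word σ)
unique σ = isPermutation⇒unique (isPerm σ)

Std-word : ∀ σ → Std (word σ) ≡ σ
Std-word σ = word-injective (std-permutation (isPerm σ))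

P-Std : Unique u → P (Std u) ≡ shapes u
P-Std {u} uu = trans (P≡shapes (Std u)) (shapes-std uu)

#nodes-P : ∀ σ → #nodes (proj₁ (P σ)) ≡ size σ
#nodes-P σ = trans (cong (#nodes ∘ proj₁) (P≡shapes σ))
  (trans (#nodes-shape-bst (reverse (word σ))) (Listₚ.length-reverse (word σ)))

P⇒size : ∀ {σ τ} → P σ ≡ P τ → size σ ≡ size τ
P⇒size {σ} {τ} p = trans (sym (#nodes-P σ)) (trans (cong (#nodes ∘ proj₁) p) (#nodes-P τ))

P⇒↭ : ∀ {σ τ} → P σ ≡ P τ → word σ ↭ word τ
P⇒↭ {σ} {τ} p = isPermutation-↭ (isPerm σ) (isPerm τ) (P⇒size {σ} {τ} p)

-- The number of nodes reveals the size, hence the letters, so the labels that `P` forgets are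
-- recovered.
P⇒∼ : ∀ {σ τ} → P σ ≡ P τ → word σ ∼ word τ
P⇒∼ {σ} {τ} p = shapes⇒∼ (P⇒↭ {σ} {τ} p) (trans (sym (P≡shapes σ)) (trans p (P≡shapes τ)))

∼⇒P-Std : Unique u → Unique v → u ∼ v → P (Std u) ≡ P (Std v)
∼⇒P-Std uu uv p = trans (P-Std uu) (trans (∼⇒shapes p) (sym (P-Std uv)))

-- The factors that π would have as a shifted shuffle whose left factor has size m: the letters 1 to
-- m, and the larger ones.
low high : ℕ → 𝔖 → 𝔖
low  m π = Std (filter (_<? suc m) (word π))
high m π = Std (filter (¬? ∘ (_<? suc m)) (word π))

P-low : ∀ m {π ρ} → P π ≡ P ρ → P (low m π) ≡ P (low m ρ)
P-low m {π} {ρ} p = ∼⇒P-Std (Uniqueₚ.filter⁺ (_<? suc m) (unique π)) (Uniqueₚ.filter⁺ (_<? suc m) (unique ρ))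
  (∼-filter (_<? suc m) (below (suc m)) (bst-filter-< (suc m)) (P⇒∼ {π} {ρ} p))

P-high : ∀ m {π ρ} → P π ≡ P ρ → P (high m π) ≡ P (high m ρ)
P-high m {π} {ρ} p = ∼⇒P-Std (Uniqueₚ.filter⁺ Q? (unique π)) (Uniqueₚ.filter⁺ Q? (unique ρ))
  (∼-filter Q? (above (suc m)) (bst-filter-≮ (suc m)) (P⇒∼ {π} {ρ} p))
  where Q? = ¬? ∘ (_<? suc m)

-- Shuffles

∈-⧢ˡ : ∀ {x} u v → w ∈ u ⧢ v → x ∷ w ∈ (x ∷ u) ⧢ v
∈-⧢ˡ []      []      (here refl) = here refl
∈-⧢ˡ (_ ∷ _) []      (here refl) = here refl
∈-⧢ˡ u       (_ ∷ _) p           = ∈ₚ.∈-++⁺ˡ (∈ₚ.∈-map⁺ _ p)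

∈-⧢ʳ : ∀ {y} u v → w ∈ u ⧢ v → y ∷ w ∈ u ⧢ (y ∷ v)
∈-⧢ʳ []      v (here refl) = here refl
∈-⧢ʳ (x ∷ u) v p           = ∈ₚ.∈-++⁺ʳ (map (x ∷_) (u ⧢ _)) (∈ₚ.∈-map⁺ _ p)

module _ {q} {Q : Pred ℕ q} (Q? : Decidable Q) where

  ∈-⧢⁺ : ∀ w → w ∈ filter Q? w ⧢ filter (¬? ∘ Q?) w
  ∈-⧢⁺ []      = here refl
  ∈-⧢⁺ (x ∷ w) with Q? x
  ... | yes _ = ∈-⧢ˡ (filter Q? w) _ (∈-⧢⁺ w)
  ... | no  _ = ∈-⧢ʳ (filter Q? w) _ (∈-⧢⁺ w)

  filter-⧢ : ∀ {u v} → All Q u → All (¬_ ∘ Q) v →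
             All (λ w → filter Q? w ≡ u × filter (¬? ∘ Q?) w ≡ v) (u ⧢ v)
  filter-⧢ {[]} {v} _ nv =
    (Listₚ.filter-none Q? nv , Listₚ.filter-all (¬? ∘ Q?) nv) ∷ []
  filter-⧢ {x ∷ u} {[]} qu _ =
    (Listₚ.filter-all Q? qu , Listₚ.filter-none (¬? ∘ Q?) (All.map (λ q ¬q → ¬q q) qu)) ∷ []
  filter-⧢ {x ∷ u} {y ∷ v} (q ∷ qu) (nq ∷ nv) = Allₚ.++⁺
    (Allₚ.map⁺ (All.map (λ (p , p′) → trans (Listₚ.filter-accept Q? q) (cong (x ∷_) p)
                                    , trans (Listₚ.filter-reject (¬? ∘ Q?) λ ¬q → ¬q q) p′)
                        (filter-⧢ qu (nq ∷ nv))))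
    (Allₚ.map⁺ (All.map (λ (p , p′) → trans (Listₚ.filter-reject Q? nq) p
                                    , trans (Listₚ.filter-accept (¬? ∘ Q?) nq) (cong (y ∷_) p′))
                        (filter-⧢ (q ∷ qu) nv)))

  -- The first letter of a shuffle shows, through Q, which word it comes from, so the two branches
  -- of the recursion are disjoint.
  ⧢-unique : ∀ {u v} → All Q u → All (¬_ ∘ Q) v → Unique (u ⧢ v)
  ⧢-unique {[]}    _ _ = [] ∷ []
  ⧢-unique {x ∷ u} {[]} _ _ = [] ∷ []
  ⧢-unique {x ∷ u} {y ∷ v} (q ∷ qu) (nq ∷ nv) = Uniqueₚ.++⁺
    (Uniqueₚ.map⁺ Listₚ.∷-injectiveʳ (⧢-unique qu (nq ∷ nv)))
    (Uniqueₚ.map⁺ Listₚ.∷-injectiveʳ (⧢-unique (q ∷ qu) nv))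
    λ (p , p′) → case ∈ₚ.∈-map⁻ (x ∷_) p , ∈ₚ.∈-map⁻ (y ∷_) p′ of λ where
      ((_ , _ , refl) , (_ , _ , r)) → nq (subst Q (Listₚ.∷-injectiveˡ r) q)

map-word-attach : ∀ ws .(ps : All IsPermutation ws) → map word (attach ws ps) ≡ ws
map-word-attach []       _  = refl
map-word-attach (w ∷ ws) ps = cong (w ∷_) (map-word-attach ws (All.tail ps))

-- The words underlying `_⧢̅_`, on which membership and uniqueness can be studied without the
-- irrelevant proofs that `attach` carries.
_⧢′_ : 𝔖 → 𝔖 → List Word
σ ⧢′ ν = word σ ⧢ shiftBy (size σ) (word ν)

map-word-⧢̅ : ∀ σ ν → map word (σ ⧢̅ ν) ≡ σ ⧢′ ν
map-word-⧢̅ σ ν = map-word-attach (σ ⧢′ ν) _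

∈-map-word⁻ : ∀ {π Π} → word π ∈ map word Π → π ∈ Π
∈-map-word⁻ p with ∈ₚ.∈-map⁻ word p
... | ρ , ρ∈Π , e = subst (_∈ _) (sym (word-injective e)) ρ∈Π

#smaller-shiftBy : ∀ m x u → #smaller (m + x) (shiftBy m u) ≡ #smaller x u
#smaller-shiftBy m x []      = refl
#smaller-shiftBy m x (z ∷ u) with z <? x
... | yes z<x = trans (#smaller-accept (ℕₚ.+-monoʳ-< m z<x) _)
  (trans (cong suc (#smaller-shiftBy m x u)) (sym (#smaller-accept z<x u)))
... | no  z≮x = trans (#smaller-reject (z≮x ∘ ℕₚ.+-cancelˡ-< m _ _) _)
  (trans (#smaller-shiftBy m x u) (sym (#smaller-reject z≮x u)))

std-shiftBy : ∀ m u → std (shiftBy m u) ≡ std u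
std-shiftBy m []      = refl
std-shiftBy m (x ∷ u) = cong₂ (λ k s → suc k ∷ map (bump k) s) (#smaller-shiftBy m x u) (std-shiftBy m u)

letters≤ : ∀ σ → All (_< suc (size σ)) (word σ)
letters≤ σ = All-resp-↭ (↭-sym (isPerm σ)) (Allₚ.applyUpTo⁺₁ suc (size σ) s≤s)

letters> : ∀ m ν → All (¬_ ∘ (_< suc m)) (shiftBy m (word ν))
letters> m ν = Allₚ.map⁺ (All-resp-↭ (↭-sym (isPerm ν))
  (Allₚ.applyUpTo⁺₂ suc (size ν) λ i → ℕₚ.≤⇒≯ (ℕₚ.m<m+n m (s≤s z≤n))))

⧢̅-unique : ∀ σ ν → Unique (σ ⧢̅ ν)
⧢̅-unique σ ν = Uniqueₚ.map⁻ (subst Unique (sym (map-word-⧢̅ σ ν))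
  (⧢-unique (_<? suc (size σ)) (letters≤ σ) (letters> (size σ) ν)))

low-↭ : ∀ m π → m ≤ size π → filter (_<? suc m) (word π) ↭ [1⋯ m ]
low-↭ m π m≤n = ↭-trans (filter-↭ (_<? suc m) (isPerm π)) (↭-reflexive (begin
  filter (_<? suc m) [1⋯ size π ]             ≡⟨ cong (λ n → filter (_<? suc m) [1⋯ n ]) (ℕₚ.m+[n∸m]≡n m≤n) ⟨
  filter (_<? suc m) [1⋯ m + (size π ∸ m) ]   ≡⟨ filter-< m _ ⟩
  [1⋯ m ]                                     ∎))
  where open ≡-Reasoning

high-↭ : ∀ m π → m ≤ size π → filter (¬? ∘ (_<? suc m)) (word π) ↭ shiftBy m [1⋯ size π ∸ m ]
high-↭ m π m≤n = ↭-trans (filter-↭ Q? (isPerm π)) (↭-reflexive (begin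
  filter Q? [1⋯ size π ]             ≡⟨ cong (λ n → filter Q? [1⋯ n ]) (ℕₚ.m+[n∸m]≡n m≤n) ⟨
  filter Q? [1⋯ m + (size π ∸ m) ]   ≡⟨ filter-≮ m _ ⟩
  shiftBy m [1⋯ size π ∸ m ]         ∎))
  where
  open ≡-Reasoning
  Q? = ¬? ∘ (_<? suc m)

size-low : ∀ {m} π → m ≤ size π → size (low m π) ≡ m
size-low {m} π m≤n = trans (length-std (filter (_<? suc m) (word π)))
  (trans (↭-length (low-↭ m π m≤n)) (Listₚ.length-applyUpTo suc m))

-- The position m is independent of σ so that it can serve as a summation index; among m up to
-- `size π`, only `size σ` can qualify.
IsSplit : 𝔖 → 𝔖 → 𝔖 → ℕ → Set
IsSplit σ ν π m = low m π ≡ σ × high m π ≡ ν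

∈-⧢̅⁻ : ∀ {σ ν π} → π ∈ σ ⧢̅ ν → size σ ≤ size π × IsSplit σ ν π (size σ)
∈-⧢̅⁻ {σ} {ν} {π} p = subst (size σ ≤_) (sym length-π) (ℕₚ.m≤m+n _ _)
  , trans (cong Std (proj₁ fs)) (Std-word σ)
  , word-injective (begin
      std (filter (¬? ∘ (_<? suc (size σ))) (word π))  ≡⟨ cong std (proj₂ fs) ⟩
      std (shiftBy (size σ) (word ν))                  ≡⟨ std-shiftBy (size σ) (word ν) ⟩
      std (word ν)                                     ≡⟨ std-permutation (isPerm ν) ⟩
      word ν                                           ∎)
  where
  open ≡-Reasoning
  w∈ : word π ∈ σ ⧢′ ν
  w∈ = subst (word π ∈_) (map-word-⧢̅ σ ν) (∈ₚ.∈-map⁺ word p)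
  fs = All.lookup (filter-⧢ (_<? suc (size σ)) (letters≤ σ) (letters> (size σ) ν)) w∈
  length-π : size π ≡ size σ + length (shiftBy (size σ) (word ν))
  length-π = trans (↭-length (All.lookup (⧢-↭ (word σ) _) w∈)) (length-++ (word σ))

-- The letters of π up to m form a permutation, which `std` fixes, so they spell σ itself. The
-- larger letters of π and the shifted ν have the same letters and the same standardization, hence
-- agree by `std-injective`.
∈-⧢̅⁺ : ∀ {σ ν π} → size σ ≤ size π → IsSplit σ ν π (size σ) → π ∈ σ ⧢̅ ν
∈-⧢̅⁺ {σ} {ν} {π} m≤n (l , h) = ∈-map-word⁻ (subst (word π ∈_) (sym (map-word-⧢̅ σ ν))
  (subst₂ (λ u v → word π ∈ u ⧢ v) low≡ high≡ (∈-⧢⁺ (_<? suc m) (word π))))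
  where
  open ≡-Reasoning
  m = size σ
  wl = filter (_<? suc m) (word π)
  wh = filter (¬? ∘ (_<? suc m)) (word π)
  low-perm : IsPermutation wl
  low-perm = ↭-trans (low-↭ m π m≤n) (↭-reflexive (cong [1⋯_] (trans (sym (size-low π m≤n)) (length-std wl))))
  low≡ : wl ≡ word σ
  low≡ = trans (sym (std-permutation low-perm)) (cong word l)
  size-ν : size ν ≡ size π ∸ m
  size-ν = begin
    size ν                                 ≡⟨ cong size h ⟨
    size (high m π)                        ≡⟨ length-std wh ⟩
    length wh                              ≡⟨ ↭-length (high-↭ m π m≤n) ⟩
    length (shiftBy m [1⋯ size π ∸ m ])    ≡⟨ length-map (m +_) [1⋯ size π ∸ m ] ⟩
    length [1⋯ size π ∸ m ]                ≡⟨ Listₚ.length-applyUpTo suc _ ⟩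
    size π ∸ m                             ∎
  high≡ : wh ≡ shiftBy m (word ν)
  high≡ = std-injective (Uniqueₚ.filter⁺ (¬? ∘ (_<? suc m)) (unique π))
    (↭-trans (high-↭ m π m≤n) (↭-sym (↭ₚ.map⁺ (m +_)
      (↭-trans (isPerm ν) (↭-reflexive (cong [1⋯_] size-ν))))))
    (begin
      std wh                     ≡⟨ cong word h ⟩
      word ν                     ≡⟨ std-permutation (isPerm ν) ⟨
      std (word ν)               ≡⟨ std-shiftBy m (word ν) ⟨
      std (shiftBy m (word ν))   ∎)

-- Deconcatenation

take-++-length : ∀ (u : List A) {v n} → length u ≡ n → take n (u ++ v) ≡ u
take-++-length []      refl = refl
take-++-length (x ∷ u) refl = cong (x ∷_) (take-++-length u refl)

drop-++-length : ∀ (u : List A) {v n} → length u ≡ n → drop n (u ++ v) ≡ v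
drop-++-length []      refl = refl
drop-++-length (x ∷ u) refl = drop-++-length u refl

cut : 𝔖 → ℕ → 𝔖 × 𝔖
cut π k = Std (take k (word π)) , Std (drop k (word π))

size-cut : ∀ {k} π → k ≤ size π → size (proj₁ (cut π k)) ≡ k
size-cut {k} π k≤n = trans (length-std (take k (word π))) (trans (Listₚ.length-take k (word π)) (ℕₚ.m≤n⇒m⊓n≡m k≤n))

size-cut-+ : ∀ k π → size (proj₁ (cut π k)) + size (proj₂ (cut π k)) ≡ size π
size-cut-+ k π = begin
  size (proj₁ (cut π k)) + size (proj₂ (cut π k))        ≡⟨ cong₂ _+_ (length-std (take k (word π))) (length-std (drop k (word π))) ⟩
  length (take k (word π)) + length (drop k (word π))    ≡⟨ length-++ (take k (word π)) ⟨
  length (take k (word π) ++ drop k (word π))            ≡⟨ cong length (Listₚ.take++drop≡id k (word π)) ⟩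
  size π                                                 ∎
  where open ≡-Reasoning

infix 4 _at_≋ᶜ_at_

-- Two positions occur because the sizes of equivalent left factors σ and σ′ are only
-- propositionally equal.
record _at_≋ᶜ_at_ (π : 𝔖) (k : ℕ) (ρ : 𝔖) (l : ℕ) : Set where
  constructor mk≋ᶜ
  field
    prefix : take k (word π) ↭ take l (word ρ)
    suffix : drop k (word π) ↭ drop l (word ρ)

_at_≋ᶜ?_at_ : ∀ π k ρ l → Dec (π at k ≋ᶜ ρ at l)
π at k ≋ᶜ? ρ at l = map′ (λ (p , s) → mk≋ᶜ p s) (λ (mk≋ᶜ p s) → p , s)
  ((take k (word π) ↭? take l (word ρ)) ×-dec (drop k (word π) ↭? drop l (word ρ)))

≋ᶜ-sym : ∀ {π k ρ l} → π at k ≋ᶜ ρ at l → ρ at l ≋ᶜ π at k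
≋ᶜ-sym (mk≋ᶜ p s) = mk≋ᶜ (↭-sym p) (↭-sym s)

≋ᶜ-trans : ∀ {π k ρ l χ m} → π at k ≋ᶜ ρ at l → ρ at l ≋ᶜ χ at m → π at k ≋ᶜ χ at m
≋ᶜ-trans (mk≋ᶜ p s) (mk≋ᶜ q t) = mk≋ᶜ (↭-trans p q) (↭-trans s t)

-- `cut` keeps the order within each factor and forgets its letters, the relation keeps the letters
-- and forgets their order; together they determine the permutation.
≋ᶜ-cut-injective : ∀ {k π ρ} → cut π k ≡ cut ρ k → π at k ≋ᶜ ρ at k → π ≡ ρ
≋ᶜ-cut-injective {k} {π} {ρ} e (mk≋ᶜ p s) = word-injective (begin
  word π                                  ≡⟨ Listₚ.take++drop≡id k (word π) ⟨
  take k (word π) ++ drop k (word π)      ≡⟨ cong₂ _++_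
    (std-injective (Uniqueₚ.take⁺ k (unique π)) p (cong (word ∘ proj₁) e))
    (std-injective (Uniqueₚ.drop⁺ k (unique π)) s (cong (word ∘ proj₂) e)) ⟩
  take k (word ρ) ++ drop k (word ρ)      ≡⟨ Listₚ.take++drop≡id k (word ρ) ⟩
  word ρ                                  ∎)
  where open ≡-Reasoning

-- Rearranging the letters of the two factors of π into the orders of σ′ and τ′ keeps each factor in
-- its class for `_∼_`, and `∼-++` carries this to the whole word.
recut : ∀ {σ σ′ τ τ′ π} → P σ ≡ P σ′ → P τ ≡ P τ′ → cut π (size σ) ≡ (σ , τ) →
        ∃ λ ρ → P π ≡ P ρ × cut ρ (size σ′) ≡ (σ′ , τ′) × π at size σ ≋ᶜ ρ at size σ′
recut {σ} {σ′} {τ} {τ′} {π} pσ pτ e = ρ , P-π≡ , cong₂ _,_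
    (word-injective (trans (cong std take≡) std-u′))
    (word-injective (trans (cong std drop≡) std-v′))
  , mk≋ᶜ (↭-trans u↭u′ (↭-reflexive (sym take≡))) (↭-trans v↭v′ (↭-reflexive (sym drop≡)))
  where
  α = take (size σ) (word π)
  β = drop (size σ) (word π)
  uu = Uniqueₚ.take⁺ (size σ) (unique π)
  uv = Uniqueₚ.drop⁺ (size σ) (unique π)
  rearrange : ∀ {u σ σ′} → Unique u → Std u ≡ σ → P σ ≡ P σ′ → ∃ λ v → u ↭ v × std v ≡ word σ′
  rearrange {u} {σ} {σ′} uu e p = destandardize uu (isPerm σ′)
    (trans (sym (P⇒size {σ} {σ′} p)) (trans (cong size (sym e)) (length-std u)))
  ru = rearrange {σ = σ} {σ′} uu (cong proj₁ e) pσ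
  rv = rearrange {σ = τ} {τ′} uv (cong proj₂ e) pτ
  α′ = proj₁ ru
  β′ = proj₁ rv
  u↭u′ = proj₁ (proj₂ ru)
  v↭v′ = proj₁ (proj₂ rv)
  std-u′ = proj₂ (proj₂ ru)
  std-v′ = proj₂ (proj₂ rv)
  w≡ : α ++ β ≡ word π
  w≡ = Listₚ.take++drop≡id (size σ) (word π)
  w↭ : α′ ++ β′ ↭ word π
  w↭ = ↭-trans (↭ₚ.++⁺ (↭-sym u↭u′) (↭-sym v↭v′)) (↭-reflexive w≡)
  ρ : 𝔖
  ρ = perm (α′ ++ β′) (↭-trans w↭ (↭-trans (isPerm π) (↭-reflexive (cong [1⋯_] (sym (↭-length w↭))))))
  length-u′ : length α′ ≡ size σ′
  length-u′ = trans (sym (length-std α′)) (cong length std-u′)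
  take≡ = take-++-length α′ {β′} length-u′
  drop≡ = drop-++-length α′ {β′} length-u′
  ∼-rearranged : ∀ {u u′ σ σ′} → Unique u → u ↭ u′ → Std u ≡ σ → std u′ ≡ word σ′ → P σ ≡ P σ′ → u ∼ u′
  ∼-rearranged {u} {u′} {σ} {σ′} uu q e e′ p = shapes⇒∼ q (begin
    shapes u         ≡⟨ P-Std uu ⟨
    P (Std u)        ≡⟨ cong P e ⟩
    P σ              ≡⟨ p ⟩
    P σ′             ≡⟨ cong P (word-injective {Std u′} {σ′} e′) ⟨
    P (Std u′)       ≡⟨ P-Std (unique-resp-↭ uu q) ⟩
    shapes u′        ∎)
    where open ≡-Reasoning
  P-π≡ : P π ≡ P ρ
  P-π≡ = begin
    P π                ≡⟨ P≡shapes π ⟩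
    shapes (word π)    ≡⟨ cong shapes w≡ ⟨
    shapes (α ++ β)    ≡⟨ ∼⇒shapes (∼-++ (∼-rearranged {σ = σ} {σ′} uu u↭u′ (cong proj₁ e) std-u′ pσ)
                                         (∼-rearranged {σ = τ} {τ′} uv v↭v′ (cong proj₂ e) std-v′ pτ)) ⟩
    shapes (α′ ++ β′)  ≡⟨ P≡shapes ρ ⟨
    P ρ                ∎
    where open ≡-Reasoning

-- The enumeration 𝔖[ n ]

∈-words⁺ : ∀ {L} w → All (_∈ L) w → w ∈ words L (length w)
∈-words⁺ []      _        = here refl
∈-words⁺ (x ∷ w) (p ∷ ps) = ∈ₚ.∈-cartesianProductWith⁺ _∷_ p (∈-words⁺ w ps)

length-words : ∀ L n → All (λ w → length w ≡ n) (words L n)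
length-words L zero    = refl ∷ []
length-words L (suc n) = Allₚ.cartesianProductWith⁺ (setoid _) (setoid _) _∷_ L (words L n)
  λ _ w∈ → cong suc (All.lookup (length-words L n) w∈)

words-unique : ∀ {L} → Unique L → ∀ n → Unique (words L n)
words-unique uL zero    = [] ∷ []
words-unique uL (suc n) = Uniqueₚ.cartesianProductWith⁺ _∷_ Listₚ.∷-injective uL (words-unique uL n)

toPermutation-word : ∀ π → toPermutation (word π) ≡ just π
toPermutation-word (perm w p) with isPermutation? w
... | yes _ = refl
... | no ¬p = contradiction-irr p ¬p

toPermutation-just : ∀ w {π} → toPermutation w ≡ just π → word π ≡ w
toPermutation-just w e with isPermutation? w
toPermutation-just w refl | yes _ = refl

∈-mapMaybe-toPermutation⁻ : ∀ ws {π} → π ∈ mapMaybe toPermutation ws → word π ∈ ws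
∈-mapMaybe-toPermutation⁻ (w ∷ ws) p with toPermutation w in eq
... | nothing = there (∈-mapMaybe-toPermutation⁻ ws p)
∈-mapMaybe-toPermutation⁻ (w ∷ ws) (here refl) | just _ = here (toPermutation-just w eq)
∈-mapMaybe-toPermutation⁻ (w ∷ ws) (there p)   | just _ = there (∈-mapMaybe-toPermutation⁻ ws p)

mapMaybe-toPermutation-unique : ∀ {ws} → Unique ws → Unique (mapMaybe toPermutation ws)
mapMaybe-toPermutation-unique {[]}     _        = []
mapMaybe-toPermutation-unique {w ∷ ws} (p ∷ ps) with toPermutation w in eq
... | nothing = mapMaybe-toPermutation-unique ps
... | just π  = All.tabulate
  (λ ρ∈ π≡ρ → All.lookup p (∈-mapMaybe-toPermutation⁻ ws ρ∈) (trans (sym (toPermutation-just w eq)) (cong word π≡ρ)))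
  ∷ mapMaybe-toPermutation-unique ps

𝔖[_]-unique : ∀ n → Unique 𝔖[ n ]
𝔖[ n ]-unique = mapMaybe-toPermutation-unique (words-unique ([1⋯]-unique n) n)

∈-𝔖⁻ : ∀ {n π} → π ∈ 𝔖[ n ] → size π ≡ n
∈-𝔖⁻ {n} p = All.lookup (length-words [1⋯ n ] n) (∈-mapMaybe-toPermutation⁻ (words [1⋯ n ] n) p)

∈-𝔖⁺ : ∀ {n π} → size π ≡ n → π ∈ 𝔖[ n ]
∈-𝔖⁺ {n} {π} refl = Anyₚ.mapMaybe⁺ toPermutation _ (Anyₚ.map⁺ (Any.map
  (λ { refl → subst (MAny.Any (π ≡_)) (sym (toPermutation-word π)) (MAny.just refl) })
  (∈-words⁺ (word π) (All.tabulate (∈-resp-↭ (isPerm π))))))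

-- Twin binary trees

-- The side of the leaf at which the search for z ends. At a label z the search turns right, so this
-- is the leaf directly following z from left to right; d is the side of the tree itself.
direction : Fin 2 → Tree ℕ ⊤ → ℕ → Fin 2
direction d (leaf _)     z = d
direction d (node l y r) z with z <? y
... | yes _ = direction 1F l z
... | no  _ = direction 0F r z

direction-< : ∀ {z y} → z < y → ∀ d l r → direction d (node l y r) z ≡ direction 1F l z
direction-< {z} {y} z<y d l r with z <? y
... | yes _   = refl
... | no  z≮y = contradiction z<y z≮y

direction-≮ : ∀ {z y} → ¬ z < y → ∀ d l r → direction d (node l y r) z ≡ direction 0F r z
direction-≮ {z} {y} z≮y d l r with z <? y
... | yes z<y = contradiction z<y z≮y
... | no  _   = refl

-- Comparing alike with all labels, x and z follow the same path. The leaf reached by z is replaced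
-- by a node x, below which z takes one more turn.
direction-insert-same : ∀ d {x z} T → All (λ y → x < y ⇔ z < y) (inorder T) →
                        direction d (insert x T) z ≡ (if does (z <? x) then 1F else 0F)
direction-insert-same d {x} {z} (leaf _) _ with z <? x
... | yes z<x = sym (cong (if_then 1F else 0F) (dec-true (z <? x) z<x))
... | no  z≮x = sym (cong (if_then 1F else 0F) (dec-false (z <? x) z≮x))
direction-insert-same d {x} {z} (node l y r) ps with Allₚ.++⁻ˡ (inorder l) ps | Allₚ.++⁻ʳ (inorder l) ps | x <? y
... | pl | p ∷ pr | yes x<y = trans (direction-< (Equivalence.to p x<y) d _ _) (direction-insert-same 1F l pl)
... | pl | p ∷ pr | no  x≮y = trans (direction-≮ (x≮y ∘ Equivalence.from p) d _ _) (direction-insert-same 0F r pr)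

-- At each node x and z either part, and the insertion happens off the path of z, or continue to the
-- side that contains the separating label y.
direction-insert-separated : ∀ d {x y z} T → y ∈ inorder T → (x < y × ¬ z < y) ⊎ (¬ x < y × z < y) →
                             AllPairs _≤_ (inorder T) →
                             direction d (insert x T) z ≡ direction d T z
direction-insert-separated d {x} {y} {z} (node l t r) y∈ sep s
  with AllPairs-++⁻ (inorder l) s | x <? t | z <? t
... | _ , t≤r ∷ _ , l≤ | yes x<t | no  z≮t = trans (direction-≮ z≮t d _ _) refl
... | _ , t≤r ∷ _ , l≤ | no  x≮t | yes z<t = trans (direction-< z<t d _ _) refl
... | sl , t≤r ∷ _ , l≤ | yes x<t | yes z<t = trans (direction-< z<t d _ _)
  (direction-insert-separated 1F l (y∈l (∈ₚ.∈-++⁻ (inorder l) y∈)) sep sl)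
  where
  t≰y : ¬ t ≤ y
  t≰y t≤y = case sep of λ where
    (inj₁ (_ , z≮y)) → z≮y (ℕₚ.<-≤-trans z<t t≤y)
    (inj₂ (x≮y , _)) → x≮y (ℕₚ.<-≤-trans x<t t≤y)
  y∈l : y ∈ inorder l ⊎ y ∈ t ∷ inorder r → y ∈ inorder l
  y∈l (inj₁ p)           = p
  y∈l (inj₂ (here refl)) = contradiction ℕₚ.≤-refl t≰y
  y∈l (inj₂ (there p))   = contradiction (All.lookup t≤r p) t≰y
... | sl , t≤r ∷ sr , l≤ | no x≮t | no z≮t = trans (direction-≮ z≮t d _ _)
  (direction-insert-separated 0F r (y∈r (∈ₚ.∈-++⁻ (inorder l) y∈)) sep sr)
  where
  y≰t : ¬ y ≤ t
  y≰t y≤t = case sep of λ where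
    (inj₁ (x<y , _)) → x≮t (ℕₚ.<-≤-trans x<y y≤t)
    (inj₂ (_ , z<y)) → z≮t (ℕₚ.<-≤-trans z<y y≤t)
  y∈r : y ∈ inorder l ⊎ y ∈ t ∷ inorder r → y ∈ inorder r
  y∈r (inj₁ p)           = contradiction (All.head (All.lookup l≤ p)) y≰t
  y∈r (inj₂ (here refl)) = contradiction ℕₚ.≤-refl y≰t
  y∈r (inj₂ (there p))   = p

-- The separating label is z if x is smaller than z, and suc z otherwise, no value being left
-- between the two.
direction-insert-other : ∀ d {x z} w → x ∉ w → x ≢ z → x ≢ suc z → z ∈ w → suc z ∈ w →
                         direction d (bst (x ∷ w)) z ≡ direction d (bst w) z
direction-insert-other d {x} {z} w x∉w x≢z x≢1+z z∈w 1+z∈w with x <? z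
... | yes x<z = direction-insert-separated d (bst w) (∈-resp-↭ (↭-sym (inorder-bst w)) z∈w)
  (inj₁ (x<z , ℕₚ.<-irrefl refl)) (bst-sorted w)
... | no  x≮z = direction-insert-separated d (bst w) (∈-resp-↭ (↭-sym (inorder-bst w)) 1+z∈w)
  (inj₂ ((λ x<1+z → x≮z (ℕₚ.≤∧≢⇒< (ℕₚ.≤-pred x<1+z) x≢z)) , ℕₚ.n<1+n z)) (bst-sorted w)

-- The leaf between z and 1 + z is the right child of z if z is inserted after
-- 1 + z, and the left child of 1 + z otherwise.
direction-0 : ∀ d a {z b} → Unique (a ++ z ∷ b) → suc z ∈ b → direction d (bst (a ++ z ∷ b)) z ≡ 0F
direction-0 d [] {z} {b} _ _ = trans (direction-insert-same d (bst b) (All.tabulate λ _ → mk⇔ id id))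
  (cong (if_then 1F else 0F) (dec-false (z <? z) (ℕₚ.<-irrefl refl)))
direction-0 d (x ∷ a) {z} {b} (x∉ ∷ us) p = trans
  (direction-insert-other d (a ++ z ∷ b) (λ x∈ → All.lookup x∉ x∈ refl)
    (All.lookup x∉ z∈) (All.lookup x∉ 1+z∈) z∈ 1+z∈)
  (direction-0 d a us p)
  where
  z∈ = ∈ₚ.∈-++⁺ʳ a (here refl)
  1+z∈ = ∈ₚ.∈-++⁺ʳ a (there p)

direction-1 : ∀ d a {z b} → Unique (a ++ suc z ∷ b) → z ∈ b → direction d (bst (a ++ suc z ∷ b)) z ≡ 1F
-- A letter of b above z differs from 1 + z and so exceeds it: both searches follow the same path in
-- the tree of b.
direction-1 d [] {z} {b} (1+z∉b ∷ _) _ = trans (direction-insert-same d (bst b) (All.tabulate λ {y} y∈ → mk⇔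
    (λ 1+z<y → ℕₚ.<-trans (ℕₚ.n<1+n z) 1+z<y)
    (λ z<y → ℕₚ.≤∧≢⇒< z<y (All.lookup 1+z∉b (∈-resp-↭ (inorder-bst b) y∈)))))
  (cong (if_then 1F else 0F) (dec-true (z <? suc z) (ℕₚ.n<1+n z)))
direction-1 d (x ∷ a) {z} {b} (x∉ ∷ us) p = trans
  (direction-insert-other d (a ++ suc z ∷ b) (λ x∈ → All.lookup x∉ x∈ refl)
    (All.lookup x∉ z∈) (All.lookup x∉ 1+z∈) z∈ 1+z∈)
  (direction-1 d a us p)
  where
  z∈ = ∈ₚ.∈-++⁺ʳ a (there p)
  1+z∈ = ∈ₚ.∈-++⁺ʳ a (here refl)

Precedes : ℕ → ℕ → Word → Set
Precedes x y w = ∃₂ λ a b → w ≡ a ++ x ∷ b × y ∈ b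

reverse-++-∷ : ∀ (a : List A) x b → reverse (a ++ x ∷ b) ≡ reverse b ++ x ∷ reverse a
reverse-++-∷ a x b = begin
  reverse (a ++ x ∷ b)              ≡⟨ Listₚ.reverse-++ a (x ∷ b) ⟩
  reverse (x ∷ b) ++ reverse a      ≡⟨ cong (_++ reverse a) (Listₚ.unfold-reverse x b) ⟩
  (reverse b ∷ʳ x) ++ reverse a     ≡⟨ Listₚ.++-assoc (reverse b) [ x ] (reverse a) ⟩
  reverse b ++ x ∷ reverse a        ∎
  where open ≡-Reasoning

precedes-reverse : ∀ {x y} → Precedes x y w → Precedes y x (reverse w)
precedes-reverse {x = x} {y} (a , b , refl , y∈b) with ∈ₚ.∈-∃++ y∈b
... | b₁ , b₂ , refl = reverse b₂ , reverse (a ++ x ∷ b₁)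
  , trans (cong reverse (sym (Listₚ.++-assoc a (x ∷ b₁) (y ∷ b₂)))) (reverse-++-∷ (a ++ x ∷ b₁) y b₂)
  , Anyₚ.reverse⁺ (∈ₚ.∈-++⁺ʳ a (here refl))

precedes-total : ∀ {x y} → x ∈ w → y ∈ w → x ≢ y → Precedes x y w ⊎ Precedes y x w
precedes-total (here refl) (here refl) x≢y = contradiction refl x≢y
precedes-total (here refl) (there q)   _   = inj₁ ([] , _ , refl , q)
precedes-total (there p)   (here refl) _   = inj₂ ([] , _ , refl , p)
precedes-total {z ∷ _} (there p) (there q) x≢y with precedes-total p q x≢y
... | inj₁ (a , b , refl , r) = inj₁ (z ∷ a , b , refl , r)
... | inj₂ (a , b , refl , r) = inj₂ (z ∷ a , b , refl , r)

direction-precedes : ∀ {z} → Unique w → Precedes z (suc z) w → direction 0F (bst w) z ≡ 0F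
direction-precedes uw (a , b , refl , p) = direction-0 0F a uw p

direction-follows : ∀ {z} → Unique w → Precedes (suc z) z w → direction 0F (bst w) z ≡ 1F
direction-follows uw (a , b , refl , p) = direction-1 0F a uw p

-- Reversal exchanges which of z and suc z comes first, and this order alone decides the side of the
-- leaf between them.
directions-differ : ∀ {z} → Unique w → z ∈ w → suc z ∈ w →
                    direction 0F (bst (reverse w)) z ≢ direction 0F (bst w) z
directions-differ {w} {z} uw z∈w 1+z∈w eq with precedes-total z∈w 1+z∈w (ℕₚ.<⇒≢ (ℕₚ.n<1+n z))
... | inj₁ p = case trans (sym (direction-follows (unique-resp-↭ uw (↭-sym (↭-reverse w))) (precedes-reverse p)))
                    (trans eq (direction-precedes uw p)) of λ ()
... | inj₂ p = case trans (sym (direction-precedes (unique-resp-↭ uw (↭-sym (↭-reverse w))) (precedes-reverse p)))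
                    (trans eq (direction-follows uw p)) of λ ()

-- Every leaf but the first directly follows a label. The last component serves the induction: the
-- first leaf of r follows the root label y, and the search for y in r ends there because y is below
-- all labels of r.
leaves-shape : ∀ d T → AllPairs _<_ (inorder T) → ∃ λ e →
               leaves d (shape T) ≡ e ∷ map (direction d T) (inorder T) ×
               (∀ {z} → All (z <_) (inorder T) → direction d T z ≡ e)
leaves-shape d (leaf _)     _ = d , refl , λ _ → refl
leaves-shape d (node l y r) s with AllPairs-++⁻ (inorder l) s
... | sl , y<r ∷ sr , l< with leaves-shape 1F l sl | leaves-shape 0F r sr
...   | e , eq , first | e′ , eq′ , first′ = e , (begin
  leaves 1F (shape l) ++ leaves 0F (shape r)
    ≡⟨ cong₂ _++_ eq eq′ ⟩
  e ∷ map (direction 1F l) (inorder l) ++ e′ ∷ map (direction 0F r) (inorder r)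
    ≡⟨ cong (λ f → e ∷ map (direction 1F l) (inorder l) ++ f ∷ map (direction 0F r) (inorder r)) (first′ y<r) ⟨
  e ∷ map (direction 1F l) (inorder l) ++ map (direction 0F r) (y ∷ inorder r)
    ≡⟨ cong (e ∷_) (cong₂ _++_
      (Listₚ.map-cong-local (All.map (λ ps → sym (direction-< (All.head ps) d l r)) l<))
      (Listₚ.map-cong-local (All.map (λ y≤z → sym (direction-≮ (ℕₚ.≤⇒≯ y≤z) d l r)) (ℕₚ.≤-refl ∷ All.map ℕₚ.<⇒≤ y<r)))) ⟩
  e ∷ map (direction d (node l y r)) (inorder l) ++ map (direction d (node l y r)) (y ∷ inorder r)
    ≡⟨ cong (e ∷_) (Listₚ.map-++ (direction d (node l y r)) (inorder l) (y ∷ inorder r)) ⟨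
  e ∷ map (direction d (node l y r)) (inorder l ++ y ∷ inorder r) ∎)
  , λ {z} ps → case Allₚ.++⁻ʳ (inorder l) ps of λ where
      (z<y ∷ _) → trans (direction-< z<y d l r) (first (Allₚ.++⁻ˡ (inorder l) ps))
  where open ≡-Reasoning

[1⋯]-sorted : ∀ n → AllPairs _<_ [1⋯ n ]
[1⋯]-sorted n = AllPairsₚ.applyUpTo⁺₁ suc n λ i<j _ → s≤s i<j

inorder-bst-permutation : ∀ {n} w → w ↭ [1⋯ n ] → inorder (bst w) ≡ [1⋯ n ]
inorder-bst-permutation {n} w p = sorted-↭⇒≡ (bst-sorted w) (AllPairs.map ℕₚ.<⇒≤ ([1⋯]-sorted n))
  (↭-trans (inorder-bst w) p)

take-applyUpTo : ∀ (f : ℕ → A) n → take (n ∸ 1) (applyUpTo f n) ≡ applyUpTo f (n ∸ 1)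
take-applyUpTo f zero    = refl
take-applyUpTo f (suc n) = begin
  take n (applyUpTo f (suc n))    ≡⟨ cong (take n) (Listₚ.applyUpTo-∷ʳ f n) ⟨
  take n (applyUpTo f n ∷ʳ f n)   ≡⟨ take-++-length (applyUpTo f n) (Listₚ.length-applyUpTo f n) ⟩
  applyUpTo f n                   ∎
  where open ≡-Reasoning

map-Pointwise : ∀ {R : B → B → Set} {f g : A → B} {xs} → All (λ x → R (f x) (g x)) xs → Pointwise R (map f xs) (map g xs)
map-Pointwise []       = []
map-Pointwise (p ∷ ps) = p ∷ map-Pointwise ps

-- Without the first leaf there remain those following the letters 1 to n; `take` then removes the
-- one following n.
canopy-bst : ∀ {n} w → w ↭ [1⋯ n ] → canopy (shape (bst w)) ≡ map (direction 0F (bst w)) [1⋯ n ∸ 1 ]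
canopy-bst {n} w p = begin
  take (#nodes (shape (bst w)) ∸ 1) (drop 1 (leaves 0F (shape (bst w))))
    ≡⟨ cong₂ (λ m l → take (m ∸ 1) (drop 1 l)) #nodes≡ leaves≡ ⟩
  take (n ∸ 1) (map (direction 0F (bst w)) (inorder (bst w)))
    ≡⟨ cong (λ l → take (n ∸ 1) (map (direction 0F (bst w)) l)) inorder≡ ⟩
  take (n ∸ 1) (map (direction 0F (bst w)) [1⋯ n ])
    ≡⟨ Listₚ.take-map (n ∸ 1) [1⋯ n ] ⟩
  map (direction 0F (bst w)) (take (n ∸ 1) [1⋯ n ])
    ≡⟨ cong (map (direction 0F (bst w))) (take-applyUpTo suc n) ⟩
  map (direction 0F (bst w)) [1⋯ n ∸ 1 ] ∎
  where
  open ≡-Reasoning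
  inorder≡ = inorder-bst-permutation w p
  #nodes≡ : #nodes (shape (bst w)) ≡ n
  #nodes≡ = trans (#nodes-shape-bst w) (trans (↭-length p) (Listₚ.length-applyUpTo suc n))
  leaves≡ = proj₁ (proj₂ (leaves-shape 0F (bst w) (subst (AllPairs _<_) (sym inorder≡) ([1⋯]-sorted n))))

P-twin : ∀ σ → Pointwise _≢_ (canopy (proj₁ (P σ))) (canopy (proj₂ (P σ)))
P-twin σ = subst₂ (Pointwise _≢_)
  (sym (trans (cong (canopy ∘ proj₁) (P≡shapes σ)) (canopy-bst (reverse (word σ)) (↭-trans (↭-reverse (word σ)) (isPerm σ)))))
  (sym (trans (cong (canopy ∘ proj₂) (P≡shapes σ)) (canopy-bst (word σ) (isPerm σ))))
  (map-Pointwise (All.tabulate differ))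
  where
  differ : ∀ {z} → z ∈ [1⋯ size σ ∸ 1 ] → direction 0F (bst (reverse (word σ))) z ≢ direction 0F (bst (word σ)) z
  differ z∈ with ∈ₚ.∈-applyUpTo⁻ suc z∈
  -- The canopy stops at n - 1, so the successor of z is a letter too.
  ... | i , i<n-1 , refl = directions-differ (unique σ)
    (∈-resp-↭ (↭-sym (isPerm σ)) (∈ₚ.∈-applyUpTo⁺ suc (ℕₚ.<-≤-trans i<n-1 (ℕₚ.m∸n≤m (size σ) 1))))
    (∈-resp-↭ (↭-sym (isPerm σ)) (∈ₚ.∈-applyUpTo⁺ suc (1+i<n i<n-1)))
    where
    1+i<n : ∀ {i n} → i < n ∸ 1 → suc i < n
    1+i<n {n = suc n} p = s≤s p

-- Makes the indicator of each fibre of `P` a member of the family 𝐏, whose indices have to be twin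
-- pairs.
twinPair : 𝔖 → TwinPair
twinPair σ = record
  { left      = proj₁ (P σ)
  ; right     = proj₂ (P σ)
  ; same-size = trans (#nodes-P σ) (sym (#nodes-shape-bst (word σ)))
  ; twin      = P-twin σ
  }

-- Finite sums in a commutative ring

module Summation {c ℓ} (R : CommutativeRing c ℓ) where

  open CommutativeRing R
    renaming (_+_ to _+ᴿ_; refl to ≈-refl; sym to ≈-sym; trans to ≈-trans; zero to *-zero; setoid to ≈-setoid)
  open SetoidReasoning ≈-setoid
  open import Algebra.Properties.CommutativeSemigroup +-commutativeSemigroup using (interchange)

  private
    variable
      i j : Level
      I : Set i
      J : Set j
      X Y : Set

  ∑ : List I → (I → Carrier) → Carrier
  ∑ []       f = 0#
  ∑ (x ∷ xs) f = f x +ᴿ ∑ xs f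

  ∑-cong-∈ : ∀ (xs : List I) {f g : I → Carrier} → (∀ {x} → x ∈ xs → f x ≈ g x) → ∑ xs f ≈ ∑ xs g
  ∑-cong-∈ []       e = ≈-refl
  ∑-cong-∈ (x ∷ xs) e = +-cong (e (here refl)) (∑-cong-∈ xs (e ∘ there))

  ∑-cong : ∀ (xs : List I) {f g : I → Carrier} → (∀ x → f x ≈ g x) → ∑ xs f ≈ ∑ xs g
  ∑-cong xs e = ∑-cong-∈ xs λ {x} _ → e x

  ∑-zero : ∀ (xs : List I) {f : I → Carrier} → (∀ {x} → x ∈ xs → f x ≈ 0#) → ∑ xs f ≈ 0#
  ∑-zero []       e = ≈-refl
  ∑-zero (x ∷ xs) e = ≈-trans (+-cong (e (here refl)) (∑-zero xs (e ∘ there))) (+-identityˡ 0#)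

  ∑-+ : ∀ (xs : List I) (f g : I → Carrier) → ∑ xs (λ x → f x +ᴿ g x) ≈ ∑ xs f +ᴿ ∑ xs g
  ∑-+ []       f g = ≈-sym (+-identityˡ 0#)
  ∑-+ (x ∷ xs) f g = ≈-trans (+-congˡ (∑-+ xs f g)) (interchange _ _ _ _)

  ∑-*ˡ : ∀ (xs : List I) k (f : I → Carrier) → ∑ xs (λ x → k * f x) ≈ k * ∑ xs f
  ∑-*ˡ []       k f = ≈-sym (zeroʳ k)
  ∑-*ˡ (x ∷ xs) k f = ≈-trans (+-congˡ (∑-*ˡ xs k f)) (≈-sym (distribˡ k _ _))

  ∑-*ʳ : ∀ (xs : List I) k (f : I → Carrier) → ∑ xs (λ x → f x * k) ≈ ∑ xs f * k
  ∑-*ʳ xs k f = ≈-trans (∑-cong xs λ x → *-comm (f x) k) (≈-trans (∑-*ˡ xs k f) (*-comm k _))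

  ∑-++ : ∀ (xs ys : List I) (f : I → Carrier) → ∑ (xs ++ ys) f ≈ ∑ xs f +ᴿ ∑ ys f
  ∑-++ []       ys f = ≈-sym (+-identityˡ _)
  ∑-++ (x ∷ xs) ys f = ≈-trans (+-congˡ (∑-++ xs ys f)) (≈-sym (+-assoc _ _ _))

  ∑-map : ∀ (g : I → J) xs (f : J → Carrier) → ∑ (map g xs) f ≈ ∑ xs (f ∘ g)
  ∑-map g []       f = ≈-refl
  ∑-map g (x ∷ xs) f = +-congˡ (∑-map g xs f)

  ∑-swap : ∀ (xs : List I) (ys : List J) (f : I → J → Carrier) → ∑ xs (λ x → ∑ ys (f x)) ≈ ∑ ys (λ y → ∑ xs λ x → f x y)
  ∑-swap []       ys f = ≈-sym (∑-zero ys λ _ → ≈-refl)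
  ∑-swap (x ∷ xs) ys f = ≈-trans (+-congˡ (∑-swap xs ys f)) (≈-sym (∑-+ ys (f x) _))

  𝟙 : Dec X → Carrier
  𝟙 d = if does d then 1# else 0#

  𝟙-yes : (d : Dec X) → X → 𝟙 d ≈ 1#
  𝟙-yes d x = reflexive (cong (if_then 1# else 0#) (dec-true d x))

  𝟙-no : (d : Dec X) → ¬ X → 𝟙 d ≈ 0#
  𝟙-no d ¬x = reflexive (cong (if_then 1# else 0#) (dec-false d ¬x))

  𝟙-cong : (d : Dec X) (e : Dec Y) → (X → Y) → (Y → X) → 𝟙 d ≈ 𝟙 e
  𝟙-cong d (yes y) f g = 𝟙-yes d (g y)
  𝟙-cong d (no ¬y) f g = 𝟙-no d (¬y ∘ f)

  𝟙-× : (d : Dec X) (e : Dec Y) (f : Dec (X × Y)) → 𝟙 f ≈ 𝟙 d * 𝟙 e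
  𝟙-× (yes x) e f = ≈-trans (𝟙-cong f e proj₂ (x ,_)) (≈-sym (*-identityˡ _))
  𝟙-× (no ¬x) e f = ≈-trans (𝟙-no f (¬x ∘ proj₁)) (≈-sym (zeroˡ _))

  module _ {Q : Pred I 0ℓ} (Q? : Decidable Q) where

    -- Exclusivity is demanded of Q rather than of the entries, so that Q may also be membership in
    -- a class with a single representative in xs.
    ∑-pick : ∀ {xs} {f : I → Carrier} {k} → AllPairs (λ x y → Q x → ¬ Q y) xs → Any (λ x → Q x × f x ≈ k) xs →
             ∑ xs (λ x → 𝟙 (Q? x) * f x) ≈ k
    ∑-pick {x ∷ xs} {f} {k} (ex ∷ _) (here (q , e)) = begin
      𝟙 (Q? x) * f x +ᴿ ∑ xs (λ y → 𝟙 (Q? y) * f y)  ≈⟨ +-cong (*-congʳ (𝟙-yes (Q? x) q)) (∑-zero xs λ {y} y∈ →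
        ≈-trans (*-congʳ (𝟙-no (Q? y) (All.lookup ex y∈ q))) (zeroˡ _)) ⟩
      1# * f x +ᴿ 0#                                  ≈⟨ +-identityʳ _ ⟩
      1# * f x                                        ≈⟨ *-identityˡ _ ⟩
      f x                                             ≈⟨ e ⟩
      k                                               ∎
    ∑-pick {x ∷ xs} {f} {k} (ex ∷ exs) (there p) = begin
      𝟙 (Q? x) * f x +ᴿ ∑ xs (λ y → 𝟙 (Q? y) * f y)  ≈⟨ +-cong (*-congʳ (𝟙-no (Q? x) ¬q)) (∑-pick exs p) ⟩
      0# * f x +ᴿ k                                   ≈⟨ +-congʳ (zeroˡ _) ⟩
      0# +ᴿ k                                         ≈⟨ +-identityˡ k ⟩
      k                                               ∎
      where
      ¬q : ¬ Q x
      ¬q q = All.lookup ex (proj₁ (proj₂ (find p))) q (proj₁ (proj₂ (proj₂ (find p))))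

    ∑-𝟙 : ∀ {xs} → AllPairs (λ x y → Q x → ¬ Q y) xs → (d : Dec X) → (X → Any Q xs) → (Any Q xs → X) →
          ∑ xs (λ x → 𝟙 (Q? x)) ≈ 𝟙 d
    ∑-𝟙 {xs = xs} ex (yes x) f g = ≈-trans (∑-cong xs λ y → ≈-sym (*-identityʳ _))
      (∑-pick ex (Any.map (_, ≈-refl) (f x)))
    ∑-𝟙 {xs = xs} ex (no ¬x) f g = ∑-zero xs λ {y} y∈ → 𝟙-no (Q? y) λ q → ¬x (g (lose y∈ q))

  -- The linear extension of f, evaluated at x. It is defined on lists, for arbitrary index sets;
  -- `⟪⟫-resp-≋` shows that it descends to the free module.
  ⟪_,_⟫ : (I → Carrier) → List (Carrier × I) → Carrier
  ⟪ f , x ⟫ = ∑ x λ (k , i) → k * f i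

  ⟪⟫-cong-∈ : ∀ (x : List (Carrier × I)) {f g : I → Carrier} → (∀ {k i} → (k , i) ∈ x → f i ≈ g i) → ⟪ f , x ⟫ ≈ ⟪ g , x ⟫
  ⟪⟫-cong-∈ x e = ∑-cong-∈ x λ p → *-congˡ (e p)

  ⟪⟫-cong : ∀ (x : List (Carrier × I)) {f g : I → Carrier} → (∀ i → f i ≈ g i) → ⟪ f , x ⟫ ≈ ⟪ g , x ⟫
  ⟪⟫-cong x e = ⟪⟫-cong-∈ x λ {_} {i} _ → e i

  ⟪⟫-+ : ∀ (x : List (Carrier × I)) (f g : I → Carrier) → ⟪ (λ i → f i +ᴿ g i) , x ⟫ ≈ ⟪ f , x ⟫ +ᴿ ⟪ g , x ⟫
  ⟪⟫-+ x f g = ≈-trans (∑-cong x λ _ → distribˡ _ _ _) (∑-+ x _ _)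

  ⟪⟫-*ʳ : ∀ (x : List (Carrier × I)) l (f : I → Carrier) → ⟪ (λ i → f i * l) , x ⟫ ≈ ⟪ f , x ⟫ * l
  ⟪⟫-*ʳ x l f = ≈-trans (∑-cong x λ _ → ≈-sym (*-assoc _ _ _)) (∑-*ʳ x l _)

  ⟪⟫-∑ : ∀ (x : List (Carrier × I)) (ys : List J) (f : I → J → Carrier) →
         ⟪ (λ i → ∑ ys (f i)) , x ⟫ ≈ ∑ ys (λ y → ⟪ (λ i → f i y) , x ⟫)
  ⟪⟫-∑ x ys f = ≈-trans (∑-cong x λ (k , i) → ≈-sym (∑-*ˡ ys k (f i))) (∑-swap x ys _)

  -- Free modules and coefficients constant on classes

  module FreeModuleProperties {B : Set} (_≟ᴮ_ : DecidableEquality B) where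

    open FreeModule ring _≟ᴮ_ public using (Lin; coeff; _≋_; mk≋; coeff-≈; scale; coeff-++; coeff-scale; leftModule)

    δ : B → B → Carrier
    δ e b = 𝟙 (e ≟ᴮ b)

    if-* : ∀ (b : Bool) k → (if b then k else 0#) ≈ k * (if b then 1# else 0#)
    if-* true  k = ≈-sym (*-identityʳ k)
    if-* false k = ≈-sym (zeroʳ k)

    coeff-⟪⟫ : ∀ e x → coeff e x ≈ ⟪ δ e , x ⟫
    coeff-⟪⟫ e []            = ≈-refl
    coeff-⟪⟫ e ((k , b) ∷ x) = +-cong (if-* (does (e ≟ᴮ b)) k) (coeff-⟪⟫ e x)

    ⟪⟫-scale : ∀ f k x → ⟪ f , scale k x ⟫ ≈ k * ⟪ f , x ⟫
    ⟪⟫-scale f k x = ≈-trans (∑-map _ x _) (≈-trans (∑-cong x λ _ → *-assoc _ _ _) (∑-*ˡ x k _))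

    ⟪⟫-linearCombination : ∀ f (v : I → Lin) ks →
      ⟪ f , linearCombination leftModule v ks ⟫ ≈ ⟪ (λ i → ⟪ f , v i ⟫) , ks ⟫
    ⟪⟫-linearCombination f v []             = ≈-refl
    ⟪⟫-linearCombination f v ((k , i) ∷ ks) = ≈-trans (∑-++ (scale k (v i)) _ _)
      (+-cong (⟪⟫-scale f k (v i)) (⟪⟫-linearCombination f v ks))

    coeff-linearCombination : ∀ e (v : I → Lin) ks →
      coeff e (linearCombination leftModule v ks) ≈ ⟪ (λ i → coeff e (v i)) , ks ⟫
    coeff-linearCombination e v ks = begin
      coeff e (linearCombination leftModule v ks)     ≈⟨ coeff-⟪⟫ e (linearCombination leftModule v ks) ⟩
      ⟪ δ e , linearCombination leftModule v ks ⟫     ≈⟨ ⟪⟫-linearCombination (δ e) v ks ⟩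
      ⟪ (λ i → ⟪ δ e , v i ⟫) , ks ⟫                  ≈⟨ ⟪⟫-cong ks (λ i → coeff-⟪⟫ e (v i)) ⟨
      ⟪ (λ i → coeff e (v i)) , ks ⟫                  ∎

    ⟪⟫-support : ∀ f {es} x → Unique es → (∀ {k b} → (k , b) ∈ x → b ∈ es) →
                 ⟪ f , x ⟫ ≈ ∑ es (λ e → coeff e x * f e)
    ⟪⟫-support f {es} x u s = begin
      ⟪ f , x ⟫                                     ≈⟨ ∑-cong-∈ x (λ {(k , b)} p → *-congˡ (pick (s p))) ⟨
      ⟪ (λ b → ∑ es (λ e → δ e b * f e)) , x ⟫      ≈⟨ ⟪⟫-∑ x es _ ⟩
      ∑ es (λ e → ⟪ (λ b → δ e b * f e) , x ⟫)      ≈⟨ ∑-cong es (λ e → ≈-trans (⟪⟫-*ʳ x (f e) (δ e)) (*-congʳ (≈-sym (coeff-⟪⟫ e x)))) ⟩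
      ∑ es (λ e → coeff e x * f e)                  ∎
      where
      pick : ∀ {b} → b ∈ es → ∑ es (λ e → δ e b * f e) ≈ f b
      pick {b} b∈ = ∑-pick (_≟ᴮ b) (AllPairs.map (λ x≢y p q → x≢y (trans p (sym q))) u)
        (Any.map (λ { refl → refl , ≈-refl }) b∈)

    open import Data.List.Relation.Unary.Unique.DecPropositional.Properties _≟ᴮ_ using (deduplicate-!)

    -- Both sums are regrouped over one duplicate-free list containing all basis elements of x and
    -- y, after which only coefficients enter.
    ⟪⟫-resp-≋ : ∀ f {x y} → x ≋ y → ⟪ f , x ⟫ ≈ ⟪ f , y ⟫
    ⟪⟫-resp-≋ f {x} {y} p = begin
      ⟪ f , x ⟫                        ≈⟨ ⟪⟫-support f x (deduplicate-! _) (λ q → ∈ₚ.∈-deduplicate⁺ _≟ᴮ_ (∈ₚ.∈-map⁺ proj₂ (∈ₚ.∈-++⁺ˡ q))) ⟩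
      ∑ es (λ e → coeff e x * f e)     ≈⟨ ∑-cong es (λ e → *-congʳ (coeff-≈ p e)) ⟩
      ∑ es (λ e → coeff e y * f e)     ≈⟨ ⟪⟫-support f y (deduplicate-! _) (λ q → ∈ₚ.∈-deduplicate⁺ _≟ᴮ_ (∈ₚ.∈-map⁺ proj₂ (∈ₚ.∈-++⁺ʳ x q))) ⟨
      ⟪ f , y ⟫                        ∎
      where
      es = deduplicate _≟ᴮ_ (map proj₂ (x ++ y))

    module Classes {C : Set} (_≟ᶜ_ : DecidableEquality C) (class : B → C) where

      Invariant : Lin → Set ℓ
      Invariant x = ∀ {e f} → class e ≡ class f → coeff e x ≈ coeff f x

      _≈?_ : ∀ a b → Dec (class a ≡ class b)
      a ≈? b = class a ≟ᶜ class b

      representatives : Lin → List B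
      representatives x = deduplicate _≈?_ (map proj₂ x)

      representatives-exclusive : ∀ {e} (bs : List B) →
        AllPairs (λ a b → class e ≡ class a → ¬ class e ≡ class b) (deduplicate _≈?_ bs)
      representatives-exclusive []       = []
      representatives-exclusive (b ∷ bs) =
          All.map (λ b≉ p q → b≉ (trans (sym p) q)) (Allₚ.all-filter (¬? ∘ (b ≈?_)) (deduplicate _≈?_ bs))
        ∷ AllPairsₚ.filter⁺ (¬? ∘ (b ≈?_)) (representatives-exclusive bs)

      decompose : Lin → List (Carrier × B)
      decompose x = map (λ b → coeff b x , b) (representatives x)

      ∈-decompose⁻ : ∀ x {k b} → (k , b) ∈ decompose x → b ∈ map proj₂ x
      ∈-decompose⁻ x p with ∈ₚ.∈-map⁻ _ p
      ... | b , b∈ , refl = Anyₚ.deduplicate⁻ _≈?_ b∈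

      module _ (v : B → Lin) (coeff-v : ∀ e b → coeff e (v b) ≈ 𝟙 (e ≈? b)) where

        -- Each v b is the indicator of the class of b. If the class of e has a representative b,
        -- then e receives the coefficient at b, which invariance equates with that at e; otherwise
        -- e does not occur in x and both sides vanish.
        decompose-correct : ∀ {x} → Invariant x → x ≋ linearCombination leftModule v (decompose x)
        decompose-correct {x} inv = mk≋ λ e → ≈-sym (begin
          coeff e (linearCombination leftModule v (decompose x))   ≈⟨ coeff-linearCombination e v (decompose x) ⟩
          ⟪ (λ b → coeff e (v b)) , decompose x ⟫                  ≈⟨ ∑-map _ (representatives x) _ ⟩
          ∑ (representatives x) (λ b → coeff b x * coeff e (v b))  ≈⟨ ∑-cong (representatives x) (λ b → ≈-trans (*-comm _ _) (*-congʳ (coeff-v e b))) ⟩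
          ∑ (representatives x) (λ b → 𝟙 (e ≈? b) * coeff b x)     ≈⟨ pick e ⟩
          coeff e x                                                ∎)
          where
          pick : ∀ e → ∑ (representatives x) (λ b → 𝟙 (e ≈? b) * coeff b x) ≈ coeff e x
          pick e with Any.any? (e ≈?_) (representatives x)
          ... | yes p = ∑-pick (e ≈?_) (representatives-exclusive (map proj₂ x)) (Any.map (λ q → q , inv (sym q)) p)
          ... | no ¬p = ≈-trans
            (∑-zero (representatives x) λ {b} b∈ → ≈-trans (*-congʳ (𝟙-no (e ≈? b) λ q → ¬p (lose b∈ q))) (zeroˡ _))
            (≈-sym (≈-trans (coeff-⟪⟫ e x) (∑-zero x λ {(k , b)} p → ≈-trans (*-congˡ (𝟙-no (e ≟ᴮ b) λ { refl →
              ¬p (Anyₚ.deduplicate⁺ _≈?_ (λ q r → trans r (sym q)) (Any.map (cong class) (∈ₚ.∈-map⁺ proj₂ p))) })) (zeroʳ k))))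

unique⇒exclusive : ∀ {A : Set} {Q : A → Set} {xs : List A} → Unique xs →
                   (∀ {x y} → x ∈ xs → y ∈ xs → Q x → Q y → x ≡ y) → AllPairs (λ x y → Q x → ¬ Q y) xs
unique⇒exclusive []       e = []
unique⇒exclusive (p ∷ ps) e =
    All.tabulate (λ y∈ q q′ → All.lookup p y∈ (e (here refl) (there y∈) q q′))
  ∷ unique⇒exclusive ps λ x∈ y∈ → e (there x∈) (there y∈)

module BaxterAlgebra {c ℓ₁ ℓ₂} (K : HeytingField c ℓ₁ ℓ₂) where

  R : CommutativeRing c ℓ₁
  R = HeytingCommutativeRing.commutativeRing (HeytingField.heytingCommutativeRing K)

  open CommutativeRing R
    using (Carrier; _≈_; 0#; 1#; _*_; +-cong; +-congˡ; +-congʳ; *-cong; *-congˡ; *-congʳ; *-assoc; *-comm;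
           *-identityˡ; *-identityʳ; +-identityʳ; reflexive)
    renaming (_+_ to _+ᴿ_; refl to ≈-refl; sym to ≈-sym; trans to ≈-trans; setoid to ≈-setoid; ring to Rᵣ)
  open import Algebra.Properties.Ring Rᵣ using () renaming (+-cancelˡ to +ᴿ-cancelˡ; +-cancelʳ to +ᴿ-cancelʳ)
  open SetoidReasoning ≈-setoid
  open Summation R
  open FQSym K

  infix 4 _≟²_
  _≟²_ : DecidableEquality (𝔖 × 𝔖)
  _≟²_ = ×-≡-dec _≟_ _≟_

  P² : 𝔖 × 𝔖 → (BinaryTree × BinaryTree) × (BinaryTree × BinaryTree)
  P² (σ , τ) = P σ , P τ

  module F₁ = FreeModuleProperties _≟_
  module F₂ = FreeModuleProperties _≟²_
  module C₁ = F₁.Classes _≟ᴾ_ P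
  module C₂ = F₂.Classes (×-≡-dec _≟ᴾ_ _≟ᴾ_) P²

  -- Baxter as the space of elements invariant on the fibres of `P`

  coeff-∑𝐅 : ∀ {X : Set} {e L} → Unique L → (d : Dec X) → (X → e ∈ L) → (e ∈ L → X) →
             F₁.coeff e (∑𝐅 L) ≈ 𝟙 d
  coeff-∑𝐅 {e = e} {L} u d f g = begin
    F₁.coeff e (∑𝐅 L)           ≈⟨ F₁.coeff-⟪⟫ e (∑𝐅 L) ⟩
    ⟪ F₁.δ e , ∑𝐅 L ⟫           ≈⟨ ∑-map _ L _ ⟩
    ∑ L (λ σ → 1# * F₁.δ e σ)   ≈⟨ ∑-cong L (λ σ → *-identityˡ _) ⟩
    ∑ L (F₁.δ e)                ≈⟨ ∑-𝟙 (e ≟_) (unique⇒exclusive u λ _ _ p q → trans (sym p) q) d f g ⟩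
    𝟙 d                         ∎

  -- Summing over one size suffices because `P e` has as many nodes as e has letters; each
  -- permutation being listed once, the coefficients are 0 or 1.
  coeff-𝐏 : ∀ e J → F₁.coeff e (𝐏 J) ≈ 𝟙 (P e ≟ᴾ trees J)
  coeff-𝐏 e J = coeff-∑𝐅 (Uniqueₚ.filter⁺ Q? 𝔖[ n ]-unique) (Q? e)
    (λ p → ∈ₚ.∈-filter⁺ Q? (∈-𝔖⁺ (trans (sym (#nodes-P e)) (cong (#nodes ∘ proj₁) p))) p)
    (λ p → proj₂ (∈ₚ.∈-filter⁻ Q? {xs = 𝔖[ n ]} p))
    where
    n = #nodes (TwinPair.left J)
    Q? = λ σ → P σ ≟ᴾ trees J

  linearCombination-map : ∀ {m ℓm i j} (M : LeftModule ring m ℓm) {I : Set i} {J : Set j}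
    (v : J → LeftModule.Carrierᴹ M) (f : I → J) ks →
    linearCombination M v (map (λ (k , i) → k , f i) ks) ≡ linearCombination M (v ∘ f) ks
  linearCombination-map M v f []             = refl
  linearCombination-map M v f ((k , i) ∷ ks) =
    cong (LeftModule._+ᴹ_ M (LeftModule._*ₗ_ M k (v (f i)))) (linearCombination-map M v f ks)

  span-reindex : ∀ {m ℓm i j} (M : LeftModule ring m ℓm) {I : Set i} {J : Set j}
    (v : J → LeftModule.Carrierᴹ M) (f : I → J) {x} → Span M (v ∘ f) x → Span M v x
  span-reindex M v f {x} (ks , p) = map (λ (k , i) → k , f i) ks
    , subst (LeftModule._≈ᴹ_ M x) (sym (linearCombination-map M v f ks)) p

  𝐏-invariant : ∀ J → C₁.Invariant (𝐏 J)
  𝐏-invariant J {e} {f} p = ≈-trans (coeff-𝐏 e J) (≈-trans (reflexive (cong (λ t → 𝟙 (t ≟ᴾ trees J)) p)) (≈-sym (coeff-𝐏 f J)))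

  Baxter⇒invariant : ∀ {x} → Baxter x → C₁.Invariant x
  Baxter⇒invariant {x} (ks , p) {e} {f} q = begin
    F₁.coeff e x                                 ≈⟨ F₁.coeff-≈ p e ⟩
    F₁.coeff e (linearCombination FQSym 𝐏 ks)    ≈⟨ F₁.coeff-linearCombination e 𝐏 ks ⟩
    ⟪ (λ J → F₁.coeff e (𝐏 J)) , ks ⟫            ≈⟨ ⟪⟫-cong ks (λ J → 𝐏-invariant J q) ⟩
    ⟪ (λ J → F₁.coeff f (𝐏 J)) , ks ⟫            ≈⟨ F₁.coeff-linearCombination f 𝐏 ks ⟨
    F₁.coeff f (linearCombination FQSym 𝐏 ks)    ≈⟨ F₁.coeff-≈ p f ⟨
    F₁.coeff f x                                 ∎

  -- The decomposition is indexed by representatives σ of the classes met by x; `twinPair` turns it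
  -- into a combination over twin pairs.
  invariant⇒Baxter : ∀ {x} → C₁.Invariant x → Baxter x
  invariant⇒Baxter {x} inv = span-reindex FQSym 𝐏 twinPair
    (C₁.decompose x , C₁.decompose-correct (𝐏 ∘ twinPair) (λ e σ → coeff-𝐏 e (twinPair σ)) inv)

  𝐏-Baxter : ∀ J → Baxter (𝐏 J)
  𝐏-Baxter J = invariant⇒Baxter (𝐏-invariant J)

  -- Products

  ⟪⟫-⊗ : ∀ g x y → ⟪ g , x ⊗ y ⟫ ≈ ⟪ (λ σ → ⟪ (λ τ → g (σ , τ)) , y ⟫) , x ⟫
  ⟪⟫-⊗ g []            y = ≈-refl
  ⟪⟫-⊗ g ((k , σ) ∷ x) y = ≈-trans (∑-++ (map _ y) _ _) (+-cong
    (≈-trans (∑-map _ y _) (≈-trans (∑-cong y λ _ → *-assoc _ _ _) (∑-*ˡ y k _)))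
    (⟪⟫-⊗ g x y))

  ⟪⟫-⊗-* : ∀ f g x y → ⟪ (λ (σ , τ) → f σ * g τ) , x ⊗ y ⟫ ≈ ⟪ f , x ⟫ * ⟪ g , y ⟫
  ⟪⟫-⊗-* f g x y = begin
    ⟪ (λ (σ , τ) → f σ * g τ) , x ⊗ y ⟫             ≈⟨ ⟪⟫-⊗ _ x y ⟩
    ⟪ (λ σ → ⟪ (λ τ → f σ * g τ) , y ⟫) , x ⟫       ≈⟨ ⟪⟫-cong x (λ σ → ≈-trans (⟪⟫-cong y λ τ → *-comm _ _) (≈-trans (⟪⟫-*ʳ y (f σ) g) (*-comm _ _))) ⟩
    ⟪ (λ σ → f σ * ⟪ g , y ⟫) , x ⟫                 ≈⟨ ⟪⟫-*ʳ x _ f ⟩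
    ⟪ f , x ⟫ * ⟪ g , y ⟫                           ∎

  δ² : ∀ e f σ τ → F₂.δ (e , f) (σ , τ) ≈ F₁.δ e σ * F₁.δ f τ
  δ² e f σ τ = ≈-trans
    (𝟙-cong ((e , f) ≟² (σ , τ)) ((e ≟ σ) ×-dec (f ≟ τ)) (λ { refl → refl , refl }) λ { (refl , refl) → refl })
    (𝟙-× (e ≟ σ) (f ≟ τ) ((e ≟ σ) ×-dec (f ≟ τ)))

  coeff-⊗ : ∀ e f x y → F₂.coeff (e , f) (x ⊗ y) ≈ F₁.coeff e x * F₁.coeff f y
  coeff-⊗ e f x y = begin
    F₂.coeff (e , f) (x ⊗ y)                              ≈⟨ F₂.coeff-⟪⟫ (e , f) (x ⊗ y) ⟩
    ⟪ F₂.δ (e , f) , x ⊗ y ⟫                              ≈⟨ ⟪⟫-cong (x ⊗ y) (λ (σ , τ) → δ² e f σ τ) ⟩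
    ⟪ (λ (σ , τ) → F₁.δ e σ * F₁.δ f τ) , x ⊗ y ⟫         ≈⟨ ⟪⟫-⊗-* (F₁.δ e) (F₁.δ f) x y ⟩
    ⟪ F₁.δ e , x ⟫ * ⟪ F₁.δ f , y ⟫                       ≈⟨ *-cong (F₁.coeff-⟪⟫ e x) (F₁.coeff-⟪⟫ f y) ⟨
    F₁.coeff e x * F₁.coeff f y                           ∎

  open import Data.List.Membership.DecPropositional _≟_ using (_∈?_)

  isSplit? : ∀ σ ν π m → Dec (IsSplit σ ν π m)
  isSplit? σ ν π m = (low m π ≟ σ) ×-dec (high m π ≟ ν)

  split-exclusive : ∀ σ ν π → AllPairs (λ l m → IsSplit σ ν π l → ¬ IsSplit σ ν π m) (upTo (suc (size π)))
  split-exclusive σ ν π = unique⇒exclusive (Uniqueₚ.upTo⁺ _) λ l∈ m∈ (p , _) (q , _) → trans (sym (size≡ l∈ p)) (size≡ m∈ q)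
    where
    size≡ : ∀ {m} → m ∈ upTo (suc (size π)) → low m π ≡ σ → size σ ≡ m
    size≡ m∈ refl = size-low π (ℕₚ.≤-pred (∈ₚ.∈-upTo⁻ m∈))

  -- Membership in the shuffle couples ν to the size of σ. The sum over m replaces it by products of
  -- a function of σ and a function of ν, which factorize over x ⊗ y.
  coeff-⧢̅ : ∀ π σ ν → F₁.coeff π (∑𝐅 (σ ⧢̅ ν)) ≈ ∑ (upTo (suc (size π))) (λ m → F₁.δ (low m π) σ * F₁.δ (high m π) ν)
  coeff-⧢̅ π σ ν = begin
    F₁.coeff π (∑𝐅 (σ ⧢̅ ν))                          ≈⟨ coeff-∑𝐅 (⧢̅-unique σ ν) (π ∈? (σ ⧢̅ ν)) id id ⟩
    𝟙 (π ∈? (σ ⧢̅ ν))                                 ≈⟨ ∑-𝟙 (isSplit? σ ν π) (split-exclusive σ ν π) (π ∈? (σ ⧢̅ ν)) to from ⟨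
    ∑ ms (λ m → 𝟙 (isSplit? σ ν π m))                 ≈⟨ ∑-cong ms (λ m → 𝟙-× (low m π ≟ σ) (high m π ≟ ν) (isSplit? σ ν π m)) ⟩
    ∑ ms (λ m → F₁.δ (low m π) σ * F₁.δ (high m π) ν) ∎
    where
    ms = upTo (suc (size π))
    to : π ∈ σ ⧢̅ ν → Any (IsSplit σ ν π) ms
    to p = lose (∈ₚ.∈-upTo⁺ (s≤s (proj₁ split))) (proj₂ split)
      where split = ∈-⧢̅⁻ {σ} {ν} {π} p
    from : Any (IsSplit σ ν π) ms → π ∈ σ ⧢̅ ν
    from p with find p
    ... | m , m∈ , s with ℕₚ.≤-pred (∈ₚ.∈-upTo⁻ m∈)
    ...   | m≤n with trans (sym (cong size (proj₁ s))) (size-low π m≤n)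
    ...     | refl = ∈-⧢̅⁺ m≤n s

  coeff-μ : ∀ π z → F₁.coeff π (μ z) ≈
            ∑ (upTo (suc (size π))) (λ m → ⟪ (λ (σ , ν) → F₁.δ (low m π) σ * F₁.δ (high m π) ν) , z ⟫)
  coeff-μ π z = begin
    F₁.coeff π (μ z)                                    ≈⟨ F₁.coeff-linearCombination π _ z ⟩
    ⟪ (λ (σ , ν) → F₁.coeff π (∑𝐅 (σ ⧢̅ ν))) , z ⟫      ≈⟨ ⟪⟫-cong z (λ (σ , ν) → coeff-⧢̅ π σ ν) ⟩
    ⟪ (λ (σ , ν) → ∑ (upTo (suc (size π))) (λ m → F₁.δ (low m π) σ * F₁.δ (high m π) ν)) , z ⟫
                                                        ≈⟨ ⟪⟫-∑ z (upTo (suc (size π))) _ ⟩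
    ∑ (upTo (suc (size π))) (λ m → ⟪ (λ (σ , ν) → F₁.δ (low m π) σ * F₁.δ (high m π) ν) , z ⟫) ∎

  -- The coproduct dual to the shifted shuffle product: π is split by the values of its letters
  -- rather than by their positions.
  coeff-∙ : ∀ π x y → F₁.coeff π (x ∙ y) ≈
            ∑ (upTo (suc (size π))) (λ m → F₁.coeff (low m π) x * F₁.coeff (high m π) y)
  coeff-∙ π x y = ≈-trans (coeff-μ π (x ⊗ y)) (∑-cong (upTo (suc (size π))) λ m →
    ≈-trans (⟪⟫-⊗-* (F₁.δ (low m π)) (F₁.δ (high m π)) x y)
      (≈-sym (*-cong (F₁.coeff-⟪⟫ (low m π) x) (F₁.coeff-⟪⟫ (high m π) y))))

  ∙-invariant : ∀ {x y} → C₁.Invariant x → C₁.Invariant y → C₁.Invariant (x ∙ y)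
  ∙-invariant {x} {y} ix iy {π} {ρ} p = begin
    F₁.coeff π (x ∙ y)                                                                  ≈⟨ coeff-∙ π x y ⟩
    ∑ (upTo (suc (size π))) (λ m → F₁.coeff (low m π) x * F₁.coeff (high m π) y)        ≈⟨ ∑-cong (upTo (suc (size π))) (λ m →
      *-cong (ix (P-low m {π} {ρ} p)) (iy (P-high m {π} {ρ} p))) ⟩
    ∑ (upTo (suc (size π))) (λ m → F₁.coeff (low m ρ) x * F₁.coeff (high m ρ) y)        ≡⟨ cong (λ n → ∑ (upTo (suc n)) (λ m → F₁.coeff (low m ρ) x * F₁.coeff (high m ρ) y))
      (P⇒size {π} {ρ} p) ⟩
    ∑ (upTo (suc (size ρ))) (λ m → F₁.coeff (low m ρ) x * F₁.coeff (high m ρ) y)        ≈⟨ coeff-∙ ρ x y ⟨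
    F₁.coeff ρ (x ∙ y)                                                                  ∎

  𝟏-invariant : C₁.Invariant 𝟏
  𝟏-invariant {e} {f} p = begin
    F₁.coeff e 𝟏          ≈⟨ F₁.coeff-⟪⟫ e 𝟏 ⟩
    1# * F₁.δ e ∅ +ᴿ 0#   ≈⟨ +-congʳ (*-congˡ (𝟙-cong (e ≟ ∅) (f ≟ ∅) (≡∅ (sym (P⇒size {e} {f} p))) (≡∅ (P⇒size {e} {f} p)))) ⟩
    1# * F₁.δ f ∅ +ᴿ 0#   ≈⟨ F₁.coeff-⟪⟫ f 𝟏 ⟨
    F₁.coeff f 𝟏          ∎
    where
    ≡∅ : ∀ {σ τ} → size τ ≡ size σ → σ ≡ ∅ → τ ≡ ∅
    ≡∅ {τ = perm [] _} _ refl = refl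

  -- Coproducts

  IsCut : 𝔖 × 𝔖 → 𝔖 → Set
  IsCut (σ , τ) π = cut π (size σ) ≡ (σ , τ)

  isCut? : ∀ στ π → Dec (IsCut στ π)
  isCut? (σ , τ) π = cut π (size σ) ≟² (σ , τ)

  -- The terms of the convolution of σ and τ, the product dual to deconcatenation.
  concatenations : 𝔖 × 𝔖 → List 𝔖
  concatenations (σ , τ) = filter (isCut? (σ , τ)) 𝔖[ size σ + size τ ]

  concatenations-unique : ∀ στ → Unique (concatenations στ)
  concatenations-unique (σ , τ) = Uniqueₚ.filter⁺ (isCut? (σ , τ)) 𝔖[ size σ + size τ ]-unique

  ∈-concatenations⁺ : ∀ στ {π} → IsCut στ π → π ∈ concatenations στ
  ∈-concatenations⁺ στ@(σ , τ) {π} p = ∈ₚ.∈-filter⁺ (isCut? στ)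
    (∈-𝔖⁺ (trans (sym (size-cut-+ (size σ) π)) (cong (λ (α , β) → size α + size β) p))) p

  ∈-concatenations⁻ : ∀ στ {π} → π ∈ concatenations στ → IsCut στ π
  ∈-concatenations⁻ στ@(σ , τ) p = proj₂ (∈ₚ.∈-filter⁻ (isCut? στ) {xs = 𝔖[ size σ + size τ ]} p)

  deconcatenations : 𝔖 → Carrierᴹ²
  deconcatenations π = map (λ k → 1# , cut π k) (upTo (suc (size π)))

  coeff-deconcatenations : ∀ στ π → F₂.coeff στ (deconcatenations π) ≈ 𝟙 (isCut? στ π)
  coeff-deconcatenations στ@(σ , τ) π = begin
    F₂.coeff στ (deconcatenations π)          ≈⟨ F₂.coeff-⟪⟫ στ (deconcatenations π) ⟩
    ⟪ F₂.δ στ , deconcatenations π ⟫          ≈⟨ ∑-map _ ks _ ⟩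
    ∑ ks (λ k → 1# * F₂.δ στ (cut π k))       ≈⟨ ∑-cong ks (λ k → *-identityˡ _) ⟩
    ∑ ks (λ k → 𝟙 (στ ≟² cut π k))            ≈⟨ ∑-𝟙 (λ k → στ ≟² cut π k)
      (unique⇒exclusive (Uniqueₚ.upTo⁺ _) (λ l∈ m∈ p q → trans (sym (size≡ l∈ p)) (size≡ m∈ q)))
      (isCut? στ π) to from ⟩
    𝟙 (isCut? στ π)                           ∎
    where
    ks = upTo (suc (size π))
    size≡ : ∀ {k} → k ∈ ks → στ ≡ cut π k → size σ ≡ k
    size≡ k∈ p = trans (cong (size ∘ proj₁) p) (size-cut π (ℕₚ.≤-pred (∈ₚ.∈-upTo⁻ k∈)))
    to : IsCut στ π → Any (λ k → στ ≡ cut π k) ks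
    to p = lose (∈ₚ.∈-upTo⁺ (s≤s (subst (size σ ≤_) (trans (cong (λ (α , β) → size α + size β) (sym p)) (size-cut-+ (size σ) π))
      (ℕₚ.m≤m+n (size σ) (size τ))))) (sym p)
    from : Any (λ k → στ ≡ cut π k) ks → IsCut στ π
    from p with find p
    ... | k , k∈ , e with size≡ k∈ e
    ...   | refl = sym e

  coeff-Δ : ∀ στ x → F₂.coeff στ (Δ x) ≈ ∑ (concatenations στ) (λ π → F₁.coeff π x)
  coeff-Δ στ x = begin
    F₂.coeff στ (Δ x)                                        ≈⟨ F₂.coeff-linearCombination στ deconcatenations x ⟩
    ⟪ (λ π → F₂.coeff στ (deconcatenations π)) , x ⟫         ≈⟨ ⟪⟫-cong x (λ π → ≈-trans (coeff-deconcatenations στ π) (≈-sym (indicator π))) ⟩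
    ⟪ (λ π → ∑ (concatenations στ) (λ ρ → F₁.δ ρ π)) , x ⟫   ≈⟨ ⟪⟫-∑ x (concatenations στ) _ ⟩
    ∑ (concatenations στ) (λ ρ → ⟪ F₁.δ ρ , x ⟫)             ≈⟨ ∑-cong (concatenations στ) (λ ρ → F₁.coeff-⟪⟫ ρ x) ⟨
    ∑ (concatenations στ) (λ ρ → F₁.coeff ρ x)               ∎
    where
    indicator : ∀ π → ∑ (concatenations στ) (λ ρ → F₁.δ ρ π) ≈ 𝟙 (isCut? στ π)
    indicator π = ∑-𝟙 (_≟ π) (unique⇒exclusive (concatenations-unique στ) λ _ _ p q → trans p (sym q))
      (isCut? στ π) (λ p → Any.map sym (∈-concatenations⁺ στ p)) (λ p → ∈-concatenations⁻ στ (Any.map sym p))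

  -- Each sum is expanded into a double sum by matching every π with the unique
  -- ρ on the other side whose two factors use the same letters.
  Δ-invariant : ∀ {x} → C₁.Invariant x → C₂.Invariant (Δ x)
  Δ-invariant {x} inv {στ@(σ , τ)} {στ′@(σ′ , τ′)} p = begin
    F₂.coeff στ (Δ x)                                          ≈⟨ coeff-Δ στ x ⟩
    ∑ L (λ π → F₁.coeff π x)                                   ≈⟨ ∑-cong-∈ L (λ {π} π∈ → ∑-pick (λ ρ → match? π ρ) (exclusive στ′ π)
      (Any.map (λ (q , m) → m , inv (sym q)) (partner στ στ′ p π∈))) ⟨
    ∑ L (λ π → ∑ L′ (λ ρ → 𝟙 (match? π ρ) * F₁.coeff ρ x))     ≈⟨ ∑-swap L L′ _ ⟩
    ∑ L′ (λ ρ → ∑ L (λ π → 𝟙 (match? π ρ) * F₁.coeff ρ x))     ≈⟨ ∑-cong-∈ L′ (λ {ρ} ρ∈ → ∑-pick (λ π → match? π ρ)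
      (AllPairs.map (λ ex q r → ex (≋ᶜ-sym q) (≋ᶜ-sym r)) (exclusive στ ρ))
      (Any.map (λ (_ , m) → ≋ᶜ-sym m , ≈-refl) (partner στ′ στ (sym p) ρ∈))) ⟩
    ∑ L′ (λ ρ → F₁.coeff ρ x)                                  ≈⟨ coeff-Δ στ′ x ⟨
    F₂.coeff στ′ (Δ x)                                         ∎
    where
    L = concatenations στ
    L′ = concatenations στ′
    match? : ∀ π ρ → Dec (π at size σ ≋ᶜ ρ at size σ′)
    match? π ρ = π at size σ ≋ᶜ? ρ at size σ′
    exclusive : ∀ στ π {k} → AllPairs (λ ρ χ → π at k ≋ᶜ ρ at size (proj₁ στ) → ¬ π at k ≋ᶜ χ at size (proj₁ στ)) (concatenations στ)
    exclusive στ π = unique⇒exclusive (concatenations-unique στ) λ ρ∈ χ∈ p q →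
      ≋ᶜ-cut-injective (trans (∈-concatenations⁻ στ ρ∈) (sym (∈-concatenations⁻ στ χ∈))) (≋ᶜ-trans (≋ᶜ-sym p) q)
    partner : ∀ στ στ′ {π} → P² στ ≡ P² στ′ → π ∈ concatenations στ →
              Any (λ ρ → P π ≡ P ρ × π at size (proj₁ στ) ≋ᶜ ρ at size (proj₁ στ′)) (concatenations στ′)
    partner στ@(σ , τ) στ′@(σ′ , τ′) {π} p π∈ =
      let (ρ , q , e , m) = recut {σ} {σ′} {τ} {τ′} {π} (cong proj₁ p) (cong proj₂ p) (∈-concatenations⁻ στ π∈)
      in lose (∈-concatenations⁺ στ′ e) (q , m)

  𝐏⊗𝐏 : 𝔖 × 𝔖 → Carrierᴹ²
  𝐏⊗𝐏 (σ , τ) = 𝐏 (twinPair σ) ⊗ 𝐏 (twinPair τ)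

  coeff-𝐏⊗𝐏 : ∀ e b → F₂.coeff e (𝐏⊗𝐏 b) ≈ 𝟙 (e C₂.≈? b)
  coeff-𝐏⊗𝐏 (e , f) (σ , τ) = begin
    F₂.coeff (e , f) (𝐏 (twinPair σ) ⊗ 𝐏 (twinPair τ))                ≈⟨ coeff-⊗ e f (𝐏 (twinPair σ)) (𝐏 (twinPair τ)) ⟩
    F₁.coeff e (𝐏 (twinPair σ)) * F₁.coeff f (𝐏 (twinPair τ))         ≈⟨ *-cong (coeff-𝐏 e (twinPair σ)) (coeff-𝐏 f (twinPair τ)) ⟩
    𝟙 (e C₁.≈? σ) * 𝟙 (f C₁.≈? τ)                                     ≈⟨ 𝟙-× (e C₁.≈? σ) (f C₁.≈? τ) ((e C₁.≈? σ) ×-dec (f C₁.≈? τ)) ⟨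
    𝟙 ((e C₁.≈? σ) ×-dec (f C₁.≈? τ))                                 ≈⟨ 𝟙-cong ((e C₁.≈? σ) ×-dec (f C₁.≈? τ)) ((e , f) C₂.≈? (σ , τ))
      (λ (p , q) → cong₂ _,_ p q) (λ p → cong proj₁ p , cong proj₂ p) ⟩
    𝟙 ((e , f) C₂.≈? (σ , τ))                                         ∎

  decompose² : ∀ {z} → C₂.Invariant z → F₂._≋_ z (linearCombination FQSym⊗FQSym 𝐏⊗𝐏 (C₂.decompose z))
  decompose² = C₂.decompose-correct 𝐏⊗𝐏 coeff-𝐏⊗𝐏

  -- The indicator of a class of pairs is a pure tensor 𝐏 J ⊗ 𝐏 J′, so the decomposition into
  -- classes is already of the required form.
  invariant⇒Baxter⊗² : ∀ {z} → C₂.Invariant z → (Baxter ⊗²) z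
  invariant⇒Baxter⊗² {z} inv = span-reindex FQSym⊗FQSym (λ ((x , _) , (y , _)) → x ⊗ y)
    (λ (σ , τ) → (𝐏 (twinPair σ) , 𝐏-Baxter (twinPair σ)) , (𝐏 (twinPair τ) , 𝐏-Baxter (twinPair τ)))
    (C₂.decompose z , decompose² inv)

  -- The antipode

  ⟪⟫-⊗𝟏 : ∀ g x → ⟪ g , x ⊗ 𝟏 ⟫ ≈ ⟪ (λ σ → g (σ , ∅)) , x ⟫
  ⟪⟫-⊗𝟏 g x = ≈-trans (⟪⟫-⊗ g x 𝟏) (⟪⟫-cong x λ σ → ≈-trans (+-identityʳ _) (*-identityˡ _))

  cut-size : ∀ π → cut π (size π) ≡ (π , ∅)
  cut-size π = cong₂ _,_
    (trans (cong Std (Listₚ.take-all (size π) (word π) ℕₚ.≤-refl)) (Std-word π))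
    (cong Std (Listₚ.drop-all (size π) (word π) ℕₚ.≤-refl))

  properDeconcatenations : 𝔖 → Carrierᴹ²
  properDeconcatenations π = map (λ k → 1# , cut π k) (upTo (size π))

  -- The terms of Δ x other than those of x ⊗ 𝟏.
  Δ⁻ : Carrierᴹ → Carrierᴹ²
  Δ⁻ = linearCombination FQSym⊗FQSym properDeconcatenations

  ⟪⟫-Δ : ∀ g x → ⟪ g , Δ x ⟫ ≈ ⟪ g , Δ⁻ x ⟫ +ᴿ ⟪ (λ π → g (π , ∅)) , x ⟫
  ⟪⟫-Δ g x = begin
    ⟪ g , Δ x ⟫                                                                   ≈⟨ F₂.⟪⟫-linearCombination g deconcatenations x ⟩
    ⟪ (λ π → ⟪ g , deconcatenations π ⟫) , x ⟫                                    ≈⟨ ⟪⟫-cong x split ⟩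
    ⟪ (λ π → ⟪ g , properDeconcatenations π ⟫ +ᴿ g (π , ∅)) , x ⟫                 ≈⟨ ⟪⟫-+ x _ _ ⟩
    ⟪ (λ π → ⟪ g , properDeconcatenations π ⟫) , x ⟫ +ᴿ ⟪ (λ π → g (π , ∅)) , x ⟫ ≈⟨ +-congʳ (F₂.⟪⟫-linearCombination g properDeconcatenations x) ⟨
    ⟪ g , Δ⁻ x ⟫ +ᴿ ⟪ (λ π → g (π , ∅)) , x ⟫                                     ∎
    where
    split : ∀ π → ⟪ g , deconcatenations π ⟫ ≈ ⟪ g , properDeconcatenations π ⟫ +ᴿ g (π , ∅)
    split π = begin
      -- The index n is split off at the end of the range; its cut has an empty right factor.
      ⟪ g , deconcatenations π ⟫                            ≡⟨ cong (λ ks → ⟪ g , map term ks ⟫) (Listₚ.upTo-∷ʳ n) ⟨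
      ⟪ g , map term (upTo n ∷ʳ n) ⟫                        ≡⟨ cong (λ z → ⟪ g , z ⟫) (Listₚ.map-++ term (upTo n) [ n ]) ⟩
      ⟪ g , properDeconcatenations π ++ [ term n ] ⟫        ≈⟨ ∑-++ (properDeconcatenations π) [ term n ] _ ⟩
      ⟪ g , properDeconcatenations π ⟫ +ᴿ (1# * g (cut π n) +ᴿ 0#)
                                                            ≈⟨ +-congˡ (≈-trans (+-identityʳ _) (*-identityˡ _)) ⟩
      ⟪ g , properDeconcatenations π ⟫ +ᴿ g (cut π n)       ≡⟨ cong (λ στ → ⟪ g , properDeconcatenations π ⟫ +ᴿ g στ) (cut-size π) ⟩
      ⟪ g , properDeconcatenations π ⟫ +ᴿ g (π , ∅)         ∎
      where
      n = size π
      term : ℕ → Carrier × (𝔖 × 𝔖)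
      term k = 1# , cut π k

  coeff-Δ⁻ : ∀ στ x → F₂.coeff στ (Δ x) ≈ F₂.coeff στ (Δ⁻ x) +ᴿ F₂.coeff στ (x ⊗ 𝟏)
  coeff-Δ⁻ στ x = begin
    F₂.coeff στ (Δ x)                                             ≈⟨ F₂.coeff-⟪⟫ στ (Δ x) ⟩
    ⟪ F₂.δ στ , Δ x ⟫                                             ≈⟨ ⟪⟫-Δ (F₂.δ στ) x ⟩
    ⟪ F₂.δ στ , Δ⁻ x ⟫ +ᴿ ⟪ (λ π → F₂.δ στ (π , ∅)) , x ⟫         ≈⟨ +-cong (F₂.coeff-⟪⟫ στ (Δ⁻ x))
      (≈-trans (F₂.coeff-⟪⟫ στ (x ⊗ 𝟏)) (⟪⟫-⊗𝟏 (F₂.δ στ) x)) ⟨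
    F₂.coeff στ (Δ⁻ x) +ᴿ F₂.coeff στ (x ⊗ 𝟏)                     ∎

  -- `Δ x` and x ⊗ 𝟏 are both invariant, and `Δ⁻ x` is their difference.
  Δ⁻-invariant : ∀ {x} → C₁.Invariant x → C₂.Invariant (Δ⁻ x)
  Δ⁻-invariant {x} inv {σ , τ} {σ′ , τ′} p = +ᴿ-cancelʳ (F₂.coeff (σ , τ) (x ⊗ 𝟏)) _ _ (begin
    F₂.coeff (σ , τ) (Δ⁻ x) +ᴿ F₂.coeff (σ , τ) (x ⊗ 𝟏)           ≈⟨ coeff-Δ⁻ (σ , τ) x ⟨
    F₂.coeff (σ , τ) (Δ x)                                        ≈⟨ Δ-invariant {x} inv {σ , τ} {σ′ , τ′} p ⟩
    F₂.coeff (σ′ , τ′) (Δ x)                                      ≈⟨ coeff-Δ⁻ (σ′ , τ′) x ⟩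
    F₂.coeff (σ′ , τ′) (Δ⁻ x) +ᴿ F₂.coeff (σ′ , τ′) (x ⊗ 𝟏)       ≈⟨ +-congˡ (begin
      F₂.coeff (σ′ , τ′) (x ⊗ 𝟏)           ≈⟨ coeff-⊗ σ′ τ′ x 𝟏 ⟩
      F₁.coeff σ′ x * F₁.coeff τ′ 𝟏        ≈⟨ *-cong (inv {σ} {σ′} (cong proj₁ p)) (𝟏-invariant {τ} {τ′} (cong proj₂ p)) ⟨
      F₁.coeff σ x * F₁.coeff τ 𝟏          ≈⟨ coeff-⊗ σ τ x 𝟏 ⟨
      F₂.coeff (σ , τ) (x ⊗ 𝟏)             ∎) ⟩
    F₂.coeff (σ′ , τ′) (Δ⁻ x) +ᴿ F₂.coeff (σ , τ) (x ⊗ 𝟏)         ∎)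

  -- Bounds the entries of the list, including those that cancel, so that every x has such a bound
  -- by plain recursion.
  SizesBelow : ℕ → Carrierᴹ → Set _
  SizesBelow n x = ∀ {k π} → (k , π) ∈ x → size π < n

  Δ⁻-sizes : ∀ {n} x → SizesBelow (suc n) x → ∀ {k σ τ} → (k , (σ , τ)) ∈ Δ⁻ x → size σ < n
  Δ⁻-sizes {n} ((l , π) ∷ x) s {k} {σ} {τ} p =
    [ head , Δ⁻-sizes x (s ∘ there) ]′ (∈ₚ.∈-++⁻ (F₂.scale l (properDeconcatenations π)) p)
    where
    head : (k , (σ , τ)) ∈ F₂.scale l (properDeconcatenations π) → size σ < n
    head q =
      let (_ , t∈ , e)  = ∈ₚ.∈-map⁻ _ q
          (i , i∈ , e′) = ∈ₚ.∈-map⁻ _ t∈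
          i<size        = ∈ₚ.∈-upTo⁻ i∈
          size≡         = trans (cong (size ∘ proj₁ ∘ proj₂) (trans e (cong (λ (m , στ) → l * m , στ) e′))) (size-cut π (ℕₚ.<⇒≤ i<size))
      in ℕₚ.<-≤-trans (subst (_< size π) (sym size≡) i<size) (ℕₚ.≤-pred (s (here refl)))

  sizes-bound : ∀ x → ∃ λ n → SizesBelow n x
  sizes-bound []            = 0 , λ ()
  sizes-bound ((k , π) ∷ x) = let (n , s) = sizes-bound x in suc (size π) ⊔ n , λ where
    (here refl) → ℕₚ.m≤m⊔n (suc (size π)) n
    (there p)   → ℕₚ.<-≤-trans (s p) (ℕₚ.m≤n⊔m (suc (size π)) n)

  𝐏-sizes : ∀ {n σ} → size σ < n → SizesBelow n (𝐏 (twinPair σ))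
  𝐏-sizes {n} {σ} σ<n p =
    let (_ , q , e) = ∈ₚ.∈-map⁻ (1# ,_) p
        π∈          = proj₁ (∈ₚ.∈-filter⁻ (λ ρ → P ρ ≟ᴾ P σ) {xs = 𝔖[ #nodes (proj₁ (P σ)) ]} q)
    in subst (_< n) (sym (trans (cong (size ∘ proj₂) e) (trans (∈-𝔖⁻ π∈) (#nodes-P σ)))) σ<n

  coeff-∙𝟏 : ∀ π y → F₁.coeff π (y ∙ 𝟏) ≈ F₁.coeff π y
  coeff-∙𝟏 π y = begin
    F₁.coeff π (y ∙ 𝟏)                                          ≈⟨ F₁.coeff-linearCombination π _ (y ⊗ 𝟏) ⟩
    ⟪ (λ (σ , ν) → F₁.coeff π (∑𝐅 (σ ⧢̅ ν))) , y ⊗ 𝟏 ⟫          ≈⟨ ⟪⟫-⊗𝟏 _ y ⟩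
    ⟪ (λ σ → F₁.coeff π (∑𝐅 (σ ⧢̅ ∅))) , y ⟫                    ≈⟨ ⟪⟫-cong y (λ σ → coeff-∑𝐅 (⧢̅-unique σ ∅) (π ≟ σ) (to σ) (from σ)) ⟩
    ⟪ F₁.δ π , y ⟫                                              ≈⟨ F₁.coeff-⟪⟫ π y ⟨
    F₁.coeff π y                                                ∎
    where
    ⧢-[] : ∀ u → u ⧢ [] ≡ [ u ]
    ⧢-[] []      = refl
    ⧢-[] (_ ∷ _) = refl
    words≡ : ∀ σ → map word (σ ⧢̅ ∅) ≡ [ word σ ]
    words≡ σ = trans (map-word-⧢̅ σ ∅) (⧢-[] (word σ))
    to : ∀ σ → π ≡ σ → π ∈ σ ⧢̅ ∅
    to σ refl = ∈-map-word⁻ (subst (word σ ∈_) (sym (words≡ σ)) (here refl))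
    from : ∀ σ → π ∈ σ ⧢̅ ∅ → π ≡ σ
    from σ p = case subst (word π ∈_) (words≡ σ) (∈ₚ.∈-map⁺ word p) of λ { (here e) → word-injective e }

  module _ {S : Carrierᴹ → Carrierᴹ} (isAntipode : IsAntipode S) where

    open IsAntipode isAntipode
    open LeftModuleMorphisms.IsLeftModuleHomomorphism isLinear using (⟦⟧-cong; +ᴹ-homo; 0ᴹ-homo; *ₗ-homo)

    coeff-S : ∀ e x → F₁.coeff e (S x) ≈ ⟪ (λ σ → F₁.coeff e (S (𝐅 σ))) , x ⟫
    coeff-S e []            = F₁.coeff-≈ 0ᴹ-homo e
    coeff-S e ((k , σ) ∷ x) = begin
      F₁.coeff e (S ((k , σ) ∷ x))                              ≈⟨ F₁.coeff-≈ (⟦⟧-cong k≈) e ⟩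
      F₁.coeff e (S (F₁.scale k (𝐅 σ) ++ x))                    ≈⟨ F₁.coeff-≈ (+ᴹ-homo (F₁.scale k (𝐅 σ)) x) e ⟩
      F₁.coeff e (S (F₁.scale k (𝐅 σ)) ++ S x)                  ≈⟨ F₁.coeff-++ e (S (F₁.scale k (𝐅 σ))) (S x) ⟩
      F₁.coeff e (S (F₁.scale k (𝐅 σ))) +ᴿ F₁.coeff e (S x)     ≈⟨ +-cong
        (≈-trans (F₁.coeff-≈ (*ₗ-homo k (𝐅 σ)) e) (F₁.coeff-scale e k (S (𝐅 σ)))) (coeff-S e x) ⟩
      k * F₁.coeff e (S (𝐅 σ)) +ᴿ ⟪ (λ σ → F₁.coeff e (S (𝐅 σ))) , x ⟫ ∎
      where
      -- The two lists differ in their first scalar, k against k * 1#.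
      k≈ : F₁._≋_ ((k , σ) ∷ x) (F₁.scale k (𝐅 σ) ++ x)
      k≈ = F₁.mk≋ λ f → begin
        F₁.coeff f ((k , σ) ∷ x)                     ≈⟨ F₁.coeff-⟪⟫ f ((k , σ) ∷ x) ⟩
        k * F₁.δ f σ +ᴿ ⟪ F₁.δ f , x ⟫               ≈⟨ +-congʳ (*-congʳ (*-identityʳ k)) ⟨
        k * 1# * F₁.δ f σ +ᴿ ⟪ F₁.δ f , x ⟫          ≈⟨ F₁.coeff-⟪⟫ f (F₁.scale k (𝐅 σ) ++ x) ⟨
        F₁.coeff f (F₁.scale k (𝐅 σ) ++ x)           ∎

    -- Its linear extension is the coefficient at π of the composite of S ⊗ id with the product, so
    -- `⟪⟫-resp-≋` allows equal tensors to be exchanged in it.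
    S⟨𝐅⟩∙𝐅 : 𝔖 → 𝔖 × 𝔖 → Carrier
    S⟨𝐅⟩∙𝐅 π (σ , τ) = F₁.coeff π (S (𝐅 σ) ∙ 𝐅 τ)

    coeff-μ∘S⟨⊗⟩id : ∀ π z → F₁.coeff π (μ ((S ⟨⊗⟩ id) z)) ≈ ⟪ S⟨𝐅⟩∙𝐅 π , z ⟫
    coeff-μ∘S⟨⊗⟩id π z = begin
      F₁.coeff π (μ ((S ⟨⊗⟩ id) z))                              ≈⟨ F₁.coeff-linearCombination π _ ((S ⟨⊗⟩ id) z) ⟩
      ⟪ f , (S ⟨⊗⟩ id) z ⟫                                       ≈⟨ F₂.⟪⟫-linearCombination f _ z ⟩
      ⟪ (λ (σ , τ) → ⟪ f , S (𝐅 σ) ⊗ 𝐅 τ ⟫) , z ⟫                ≈⟨ ⟪⟫-cong z (λ (σ , τ) → F₁.coeff-linearCombination π _ (S (𝐅 σ) ⊗ 𝐅 τ)) ⟨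
      ⟪ S⟨𝐅⟩∙𝐅 π , z ⟫                                           ∎
      where
      f : 𝔖 × 𝔖 → Carrier
      f (σ , ν) = F₁.coeff π (∑𝐅 (σ ⧢̅ ν))

    coeff-S∙ : ∀ π x y → F₁.coeff π (S x ∙ y) ≈ ⟪ S⟨𝐅⟩∙𝐅 π , x ⊗ y ⟫
    coeff-S∙ π x y = begin
      F₁.coeff π (S x ∙ y)                                                        ≈⟨ coeff-∙ π (S x) y ⟩
      ∑ ms (λ m → F₁.coeff (low m π) (S x) * F₁.coeff (high m π) y)               ≈⟨ ∑-cong ms (λ m → *-cong (coeff-S (low m π) x) (F₁.coeff-⟪⟫ (high m π) y)) ⟩
      ∑ ms (λ m → ⟪ s m , x ⟫ * ⟪ F₁.δ (high m π) , y ⟫)                          ≈⟨ ∑-cong ms (λ m → ⟪⟫-⊗-* (s m) (F₁.δ (high m π)) x y) ⟨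
      ∑ ms (λ m → ⟪ (λ (σ , τ) → s m σ * F₁.δ (high m π) τ) , x ⊗ y ⟫)            ≈⟨ ⟪⟫-∑ (x ⊗ y) ms (λ (σ , τ) m → s m σ * F₁.δ (high m π) τ) ⟨
      ⟪ (λ (σ , τ) → ∑ ms (λ m → s m σ * F₁.δ (high m π) τ)) , x ⊗ y ⟫            ≈⟨ ⟪⟫-cong (x ⊗ y) (λ (σ , τ) → ≈-trans (coeff-∙ π (S (𝐅 σ)) (𝐅 τ))
        (∑-cong ms λ m → *-congˡ (coeff-𝐅 (high m π) τ))) ⟨
      ⟪ S⟨𝐅⟩∙𝐅 π , x ⊗ y ⟫                                                        ∎
      where
      ms = upTo (suc (size π))
      s : ℕ → 𝔖 → Carrier
      s m σ = F₁.coeff (low m π) (S (𝐅 σ))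
      coeff-𝐅 : ∀ e τ → F₁.coeff e (𝐅 τ) ≈ F₁.δ e τ
      coeff-𝐅 e τ = ≈-trans (F₁.coeff-⟪⟫ e (𝐅 τ)) (≈-trans (+-identityʳ _) (*-identityˡ _))

    -- The antipode axiom, solved for the summand of (S ⊗ id)(Δ x) indexed by x ⊗ 𝟏.
    antipode-recursion : ∀ π x → ⟪ S⟨𝐅⟩∙𝐅 π , Δ⁻ x ⟫ +ᴿ F₁.coeff π (S x) ≈ counit x * F₁.coeff π 𝟏
    antipode-recursion π x = begin
      ⟪ S⟨𝐅⟩∙𝐅 π , Δ⁻ x ⟫ +ᴿ F₁.coeff π (S x)                              ≈⟨ +-congˡ (coeff-S π x) ⟩
      ⟪ S⟨𝐅⟩∙𝐅 π , Δ⁻ x ⟫ +ᴿ ⟪ (λ σ → F₁.coeff π (S (𝐅 σ))) , x ⟫          ≈⟨ +-congˡ (⟪⟫-cong x λ σ → coeff-∙𝟏 π (S (𝐅 σ))) ⟨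
      ⟪ S⟨𝐅⟩∙𝐅 π , Δ⁻ x ⟫ +ᴿ ⟪ (λ σ → S⟨𝐅⟩∙𝐅 π (σ , ∅)) , x ⟫              ≈⟨ ⟪⟫-Δ (S⟨𝐅⟩∙𝐅 π) x ⟨
      ⟪ S⟨𝐅⟩∙𝐅 π , Δ x ⟫                                                   ≈⟨ coeff-μ∘S⟨⊗⟩id π (Δ x) ⟨
      F₁.coeff π (μ ((S ⟨⊗⟩ id) (Δ x)))                                    ≈⟨ F₁.coeff-≈ (inverseˡ x) π ⟩
      F₁.coeff π (F₁.scale (counit x) 𝟏)                                   ≈⟨ F₁.coeff-scale π (counit x) 𝟏 ⟩
      counit x * F₁.coeff π 𝟏                                              ∎

    -- By `antipode-recursion` the claim reduces to the terms from `Δ⁻ x`. Written through tensors 𝐏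
    -- ⊗ 𝐏 these have left factors of smaller size, where the induction hypothesis applies, and
    -- products of invariant elements are invariant.
    S-invariant : ∀ n {x} → SizesBelow n x → C₁.Invariant x → C₁.Invariant (S x)
    S-invariant zero {x} s _ {π} {ρ} _ = begin
      F₁.coeff π (S x)                             ≈⟨ coeff-S π x ⟩
      ⟪ (λ σ → F₁.coeff π (S (𝐅 σ))) , x ⟫         ≈⟨ ⟪⟫-cong-∈ x (λ p → contradiction (s p) ℕₚ.n≮0) ⟩
      ⟪ (λ σ → F₁.coeff ρ (S (𝐅 σ))) , x ⟫         ≈⟨ coeff-S ρ x ⟨
      F₁.coeff ρ (S x)                             ∎
    S-invariant (suc n) {x} s inv {π} {ρ} p = +ᴿ-cancelˡ ⟪ S⟨𝐅⟩∙𝐅 π , Δ⁻ x ⟫ _ _ (begin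
      ⟪ S⟨𝐅⟩∙𝐅 π , Δ⁻ x ⟫ +ᴿ F₁.coeff π (S x)      ≈⟨ antipode-recursion π x ⟩
      counit x * F₁.coeff π 𝟏                      ≈⟨ *-congˡ (𝟏-invariant {π} {ρ} p) ⟩
      counit x * F₁.coeff ρ 𝟏                      ≈⟨ antipode-recursion ρ x ⟨
      ⟪ S⟨𝐅⟩∙𝐅 ρ , Δ⁻ x ⟫ +ᴿ F₁.coeff ρ (S x)      ≈⟨ +-congʳ lower ⟨
      ⟪ S⟨𝐅⟩∙𝐅 π , Δ⁻ x ⟫ +ᴿ F₁.coeff ρ (S x)      ∎)
      where
      ks = C₂.decompose (Δ⁻ x)
      expand : ∀ π → ⟪ S⟨𝐅⟩∙𝐅 π , Δ⁻ x ⟫ ≈ ⟪ (λ (σ , τ) → F₁.coeff π (S (𝐏 (twinPair σ)) ∙ 𝐏 (twinPair τ))) , ks ⟫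
      expand π = begin
        ⟪ S⟨𝐅⟩∙𝐅 π , Δ⁻ x ⟫                                          ≈⟨ F₂.⟪⟫-resp-≋ (S⟨𝐅⟩∙𝐅 π) (decompose² {Δ⁻ x} λ {e} {f} → Δ⁻-invariant {x} inv {e} {f}) ⟩
        ⟪ S⟨𝐅⟩∙𝐅 π , linearCombination FQSym⊗FQSym 𝐏⊗𝐏 ks ⟫          ≈⟨ F₂.⟪⟫-linearCombination (S⟨𝐅⟩∙𝐅 π) 𝐏⊗𝐏 ks ⟩
        ⟪ (λ στ → ⟪ S⟨𝐅⟩∙𝐅 π , 𝐏⊗𝐏 στ ⟫) , ks ⟫                      ≈⟨ ⟪⟫-cong ks (λ (σ , τ) → coeff-S∙ π (𝐏 (twinPair σ)) (𝐏 (twinPair τ))) ⟨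
        ⟪ (λ (σ , τ) → F₁.coeff π (S (𝐏 (twinPair σ)) ∙ 𝐏 (twinPair τ))) , ks ⟫ ∎
      -- The representatives are chosen among the pairs listed in `Δ⁻ x`, whose left factors come
      -- from proper cuts.
      smaller : ∀ {k σ τ} → (k , (σ , τ)) ∈ ks → size σ < n
      smaller q = let (_ , r , e) = ∈ₚ.∈-map⁻ proj₂ (C₂.∈-decompose⁻ (Δ⁻ x) q)
                  in subst (λ στ → size (proj₁ στ) < n) (sym e) (Δ⁻-sizes x s r)
      lower : ⟪ S⟨𝐅⟩∙𝐅 π , Δ⁻ x ⟫ ≈ ⟪ S⟨𝐅⟩∙𝐅 ρ , Δ⁻ x ⟫
      lower = begin
        ⟪ S⟨𝐅⟩∙𝐅 π , Δ⁻ x ⟫                                                       ≈⟨ expand π ⟩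
        ⟪ (λ (σ , τ) → F₁.coeff π (S (𝐏 (twinPair σ)) ∙ 𝐏 (twinPair τ))) , ks ⟫   ≈⟨ ⟪⟫-cong-∈ ks (λ {k} {(σ , τ)} q →
          ∙-invariant {S (𝐏 (twinPair σ))} {𝐏 (twinPair τ)}
            (S-invariant n {𝐏 (twinPair σ)} (𝐏-sizes {σ = σ} (smaller q)) (𝐏-invariant (twinPair σ))) (𝐏-invariant (twinPair τ)) p) ⟩
        ⟪ (λ (σ , τ) → F₁.coeff ρ (S (𝐏 (twinPair σ)) ∙ 𝐏 (twinPair τ))) , ks ⟫   ≈⟨ expand ρ ⟨
        ⟪ S⟨𝐅⟩∙𝐅 ρ , Δ⁻ x ⟫                                                       ∎

  -- The Hopf subalgebra

  Baxter-isSubspace : IsSubspace FQSym Baxter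
  Baxter-isSubspace = record
    { resp-≈    = λ {x} {y} x≈y v → invariant⇒Baxter λ {e} {f} p → ≈-trans (≈-sym (F₁.coeff-≈ x≈y e))
        (≈-trans (Baxter⇒invariant v p) (F₁.coeff-≈ x≈y f))
    ; 0-closed  = invariant⇒Baxter λ _ → ≈-refl
    ; +-closed  = λ {x} {y} v w → invariant⇒Baxter λ {e} {f} p → ≈-trans (F₁.coeff-++ e x y)
        (≈-trans (+-cong (Baxter⇒invariant v p) (Baxter⇒invariant w p)) (≈-sym (F₁.coeff-++ f x y)))
    ; *ₗ-closed = λ k {x} v → invariant⇒Baxter λ {e} {f} p → ≈-trans (F₁.coeff-scale e k x)
        (≈-trans (*-congˡ (Baxter⇒invariant v p)) (≈-sym (F₁.coeff-scale f k x)))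
    }

  Baxter-isHopfSubalgebra : IsHopfSubalgebra Baxter
  Baxter-isHopfSubalgebra = record
    { isSubspace = Baxter-isSubspace
    ; 𝟏-closed   = invariant⇒Baxter λ {e} {f} → 𝟏-invariant {e} {f}
    ; ∙-closed   = λ {x} {y} v w → invariant⇒Baxter {x ∙ y} (∙-invariant {x} {y} (Baxter⇒invariant v) (Baxter⇒invariant w))
    ; Δ-closed   = λ {x} v → invariant⇒Baxter⊗² {Δ x} λ {e} {f} → Δ-invariant {x} (Baxter⇒invariant v) {e} {f}
    ; S-closed   = λ isAntipode {x} v → invariant⇒Baxter
        (S-invariant isAntipode (proj₁ (sizes-bound x)) {x} (proj₂ (sizes-bound x)) (Baxter⇒invariant v))
    }

theorem6p2 : ∀ {c ℓ₁ ℓ₂} (K : HeytingField c ℓ₁ ℓ₂) → CharacteristicZero K →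
    FQSym.IsHopfSubalgebra K (FQSym.Baxter K)
theorem6p2 K _ = BaxterAlgebra.Baxter-isHopfSubalgebra K
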